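{- Let $n=2^k$ for some integer $k\ge 1$, let $V=\{v\in\{ -1,1\}^n : v_1=1\}$, $g(V)=\frac12\sum_{v\in V}v$, $\mathbf{1}=(1,\dots,1)\in\mathbb{R}^n$, $M=2^{n-2}-\frac12\binom{n-1}{n/2}+\frac12$, and $K_M=\{x\in\mathbb{R}^n : x_i\le M\text{ for all } i\}$. Then there exists $w\in\mathbb{Z}^n$ with $w_i\le 1$ for all $i$ such that $0\in P(V)-g(V)-\frac12\binom{n-1}{n/2}\mathbf{1}+\frac12 w\subset K_M$, where this set denotes $\{p-g(V)-\frac12\binom{n-1}{n/2}\mathbf{1}+\frac12 w : p\in P(V)\}$.
   Context: For a finite set $W\subset\mathbb{R}^n$, $P(W):=\{\sum_{w\in S} w : S\subseteq W\}$ is the set of subset sums of $W$. -}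

module Defs where

open import Data.Nat as ℕ using (ℕ; zero; suc; _^_)
open import Data.Nat.Combinatorics using (_C_)
open import Data.Integer as ℤ using (ℤ; +_)
open import Data.Rational using (ℚ; _/_; _+_; _-_; _*_; -_; 0ℚ; 1ℚ; ½; _≤_)
open import Data.Vec using (Vec; []; _∷_; replicate; zipWith; map; lookup)
open import Data.List using (List; []; _∷_; _++_; foldr)
import Data.List as L
open import Data.List.Relation.Binary.Sublist.Propositional using (_⊆_)
open import Data.Product using (Σ; ∃; _×_)
open import Relation.Binary.PropositionalEquality using (_≡_)
open import Data.Fin using (Fin)

ℕ→ℚ : ℕ → ℚ
ℕ→ℚ m = (+ m) / 1

ℤ→ℚ : ℤ → ℚ
ℤ→ℚ z = z / 1

Vecℚ : ℕ → Set
Vecℚ n = Vec ℚ n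

_+ᵥ_ : ∀ {n} → Vecℚ n → Vecℚ n → Vecℚ n
_+ᵥ_ = zipWith _+_

_-ᵥ_ : ∀ {n} → Vecℚ n → Vecℚ n → Vecℚ n
_-ᵥ_ = zipWith _-_

_·ᵥ_ : ∀ {n} → ℚ → Vecℚ n → Vecℚ n
c ·ᵥ v = map (c *_) v

0ᵥ : ∀ {n} → Vecℚ n
0ᵥ = replicate _ 0ℚ

1ᵥ : ∀ {n} → Vecℚ n
1ᵥ = replicate _ 1ℚ

vsum : ∀ {n} → List (Vecℚ n) → Vecℚ n
vsum = foldr _+ᵥ_ 0ᵥ

allPM : (n : ℕ) → List (Vecℚ n)
allPM zero = [] ∷ []
allPM (suc m) = L.map (1ℚ ∷_) (allPM m) ++ L.map ((- 1ℚ) ∷_) (allPM m)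

Vset : (n : ℕ) → List (Vecℚ n)
Vset zero = []
Vset (suc m) = L.map (1ℚ ∷_) (allPM m)

-- P(W) for a finite set W given as a duplicate-free list:
-- p ∈ P(W) iff p is the sum of the elements of some subset S ⊆ W
-- (subsets of a duplicate-free list = its sublists)
InP : ∀ {n} → List (Vecℚ n) → Vecℚ n → Set
InP W p = Σ (List _) λ S → (S ⊆ W) × (p ≡ vsum S)

g : (n : ℕ) → Vecℚ n
g n = ½ ·ᵥ vsum (Vset n)

halfBinom : ℕ → ℚ
halfBinom n = ½ * ℕ→ℚ ((n ℕ.∸ 1) C (n ℕ./ 2))

Mval : ℕ → ℚ
Mval n = (ℕ→ℚ (2 ^ (n ℕ.∸ 2)) - halfBinom n) + ½

shift : (n : ℕ) → Vec ℤ n → Vecℚ n → Vecℚ n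
shift n w p = ((p -ᵥ g n) -ᵥ (halfBinom n ·ᵥ 1ᵥ)) +ᵥ (½ ·ᵥ map ℤ→ℚ w)

InK : (n : ℕ) → ℚ → Vecℚ n → Set
InK n M x = (i : Fin n) → lookup x i ≤ M

{-# OPTIONS --safe #-}
-- Write n = 2h + 2, β = C(n - 1, h + 1) and V = {1} × {±1}^(n-1), and take an odd f : {±1}^n → {±1}.
-- For S₀ = {v ∈ V : f v = 1} the i-th coordinate of 2 ΣS₀ − ΣV is D_i = Σ_{v ∈ V} f(v) v_i, so
-- w_i = β − D_i puts 0 into the shifted set; and since 2 ΣS − ΣV ≤ |V| = 2^(n-1) for all S ⊆ V,
-- the shifted set lies in K_M as soon as w_i ≤ 1, i.e. D_i ≥ β − 1.  As f is odd, 2 D_i is the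
-- correlation Σ_u f(u) u_i over the whole cube.  The majority sgn (Σ u) has correlation 2β with
-- every coordinate, so it suffices to break its ties (Σ u = 0) by an odd sign function t whose
-- correlation over the balanced u is at least −2.  For n = 2 and 4 the first coordinate does.  From
-- n to 2n, keep t on duplicated vectors (u₁ u₁ u₂ u₂ …), and elsewhere take the product of the
-- leading signs of the first two unequal pairs and of the next remaining pair: swapping an unequal
-- pair shows that this product is uncorrelated with every coordinate.
module Submission where

open import Defs
open import Data.Nat using (ℕ; _≤_; _^_)
open import Data.Integer as ℤ using (ℤ; +_)
open import Data.Vec using (Vec; lookup)
open import Data.Fin using (Fin)
open import Data.Product using (Σ; _×_)
open import Relation.Binary.PropositionalEquality using (_≡_)

open import Data.Bool using (Bool; true; false; if_then_else_; _∧_)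
open import Data.Empty using (⊥-elim)
open import Data.Fin using (zero; suc)
open import Data.Integer using (-[1+_]; +0; +[1+_]; 0ℤ; 1ℤ; -1ℤ; _+_; _-_; _*_; -_; _≟_)
import Data.Integer.Properties as ℤP
open import Data.Integer.Tactic.RingSolver using (solve-∀)
open import Data.List as L using (List; []; _∷_; _++_; filter; length)
import Data.List.Properties as LP
open import Data.List.Relation.Binary.Sublist.Propositional using (_⊆_; []; _∷_; _∷ʳ_)
import Data.List.Relation.Binary.Sublist.Propositional.Properties as Sublist
open import Data.List.Relation.Unary.All as All using (All; []; _∷_)
import Data.List.Relation.Unary.All.Properties as All
open import Data.Maybe as Maybe using (Maybe; just; nothing; fromMaybe; Is-just; _<∣>_)
open import Data.Maybe.Properties using (map-<∣>)
open import Data.Maybe.Relation.Unary.All as MaybeAll using (just; nothing)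
open import Data.Maybe.Relation.Unary.Any using (just)
open import Data.Nat as ℕ using (zero; suc; z≤n; s≤s; _<_)
import Data.Nat.Properties as ℕP
open import Data.Nat.Combinatorics using (_C_; nCk+nC[k+1]≡[n+1]C[k+1])
import Data.Nat.Coprimality as Coprime
open import Data.Nat.DivMod using (m*n/n≡m)
open import Data.Product using (∃; ∃₂; _,_)
open import Data.Rational as ℚ using (ℚ; mkℚ; 0ℚ; 1ℚ; ½)
import Data.Rational.Properties as ℚP
import Data.Rational.Solver as ℚSolver
open import Data.Sum using (_⊎_; inj₁; inj₂)
open import Data.Vec as Vec using ([]; _∷_; head; tabulate)
import Data.Vec.Properties as VP
open import Data.Vec.Relation.Binary.Pointwise.Extensional using (ext; Pointwise-≡⇒≡)
open import Data.Vec.Relation.Unary.All as VecAll using ([]; _∷_)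
import Data.Vec.Relation.Unary.All.Properties as VecAll
open import Function using (_∘_; _⇔_; mk⇔)
open import Relation.Nullary using (Dec; yes; no; does; contradiction)
open import Relation.Nullary.Decidable using (does-⇔)
open import Relation.Binary.PropositionalEquality using (refl; sym; trans; cong; cong₂; subst; subst₂; _≢_)
open import Relation.Binary.PropositionalEquality using (module ≡-Reasoning)

IsSign : ℤ → Set
IsSign a = a ≡ 1ℤ ⊎ a ≡ -1ℤ

IsSignVec : ∀ {m} → Vec ℤ m → Set
IsSignVec = VecAll.All IsSign

Σ± : (m : ℕ) → (Vec ℤ m → ℤ) → ℤ
Σ± zero    F = F []
Σ± (suc m) F = Σ± m (λ x → F (1ℤ ∷ x)) + Σ± m (λ x → F (-1ℤ ∷ x))

Σ±-cong : ∀ m {F G : Vec ℤ m → ℤ} → (∀ x → IsSignVec x → F x ≡ G x) → Σ± m F ≡ Σ± m G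
Σ±-cong zero    F≗G = F≗G [] []
Σ±-cong (suc m) F≗G = cong₂ _+_ (Σ±-cong m (λ x sx → F≗G _ (inj₁ refl ∷ sx)))
                                (Σ±-cong m (λ x sx → F≗G _ (inj₂ refl ∷ sx)))

Σ±-mono-≤ : ∀ m {F G : Vec ℤ m → ℤ} → (∀ x → F x ℤ.≤ G x) → Σ± m F ℤ.≤ Σ± m G
Σ±-mono-≤ zero    F≤G = F≤G []
Σ±-mono-≤ (suc m) F≤G = ℤP.+-mono-≤ (Σ±-mono-≤ m (λ x → F≤G _)) (Σ±-mono-≤ m (λ x → F≤G _))

Σ±-distrib-+ : ∀ m (F G : Vec ℤ m → ℤ) → Σ± m (λ x → F x + G x) ≡ Σ± m F + Σ± m G
Σ±-distrib-+ zero    F G = refl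
Σ±-distrib-+ (suc m) F G = begin
  Σ± m (λ x → F (1ℤ ∷ x) + G (1ℤ ∷ x)) + Σ± m (λ x → F (-1ℤ ∷ x) + G (-1ℤ ∷ x))
    ≡⟨ cong₂ _+_ (Σ±-distrib-+ m _ _) (Σ±-distrib-+ m _ _) ⟩
  (Σ± m (λ x → F (1ℤ ∷ x)) + Σ± m (λ x → G (1ℤ ∷ x)))
    + (Σ± m (λ x → F (-1ℤ ∷ x)) + Σ± m (λ x → G (-1ℤ ∷ x)))
    ≡⟨ interchange (Σ± m (λ x → F (1ℤ ∷ x))) _ _ _ ⟩
  Σ± (suc m) F + Σ± (suc m) G ∎
  where
  open ≡-Reasoning
  interchange : ∀ a b c d → (a + b) + (c + d) ≡ (a + c) + (b + d)
  interchange = solve-∀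

Σ±-distribˡ-* : ∀ m c (F : Vec ℤ m → ℤ) → Σ± m (λ x → c * F x) ≡ c * Σ± m F
Σ±-distribˡ-* zero    c F = refl
Σ±-distribˡ-* (suc m) c F =
  trans (cong₂ _+_ (Σ±-distribˡ-* m c (λ x → F (1ℤ ∷ x))) (Σ±-distribˡ-* m c (λ x → F (-1ℤ ∷ x))))
                                  (sym (ℤP.*-distribˡ-+ c (Σ± m (λ x → F (1ℤ ∷ x))) _))

Σ±-neg : ∀ m (F : Vec ℤ m → ℤ) → Σ± m (λ x → - F x) ≡ - Σ± m F
Σ±-neg zero    F = refl
Σ±-neg (suc m) F = trans (cong₂ _+_ (Σ±-neg m (λ x → F (1ℤ ∷ x))) (Σ±-neg m (λ x → F (-1ℤ ∷ x))))
                         (sym (ℤP.neg-distrib-+ (Σ± m (λ x → F (1ℤ ∷ x))) _))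

Σ±-zero : ∀ m → Σ± m (λ _ → 0ℤ) ≡ 0ℤ
Σ±-zero zero    = refl
Σ±-zero (suc m) = cong₂ _+_ (Σ±-zero m) (Σ±-zero m)

negate : ∀ {m} → Vec ℤ m → Vec ℤ m
negate = Vec.map (λ a → - a)

Σ±-∘negate : ∀ m (F : Vec ℤ m → ℤ) → Σ± m (λ x → F (negate x)) ≡ Σ± m F
Σ±-∘negate zero    F = refl
Σ±-∘negate (suc m) F =
  trans (cong₂ _+_ (Σ±-∘negate m (λ x → F (-1ℤ ∷ x))) (Σ±-∘negate m (λ x → F (1ℤ ∷ x))))
                             (ℤP.+-comm (Σ± m (λ x → F (-1ℤ ∷ x))) _)

sumℤ : ∀ {m} → Vec ℤ m → ℤ
sumℤ []      = 0ℤ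
sumℤ (a ∷ x) = a + sumℤ x

sumℤ-negate : ∀ {m} (x : Vec ℤ m) → sumℤ (negate x) ≡ - sumℤ x
sumℤ-negate []      = refl
sumℤ-negate (a ∷ x) = trans (cong (λ s → - a + s) (sumℤ-negate x)) (sym (ℤP.neg-distrib-+ a (sumℤ x)))

𝟙[_] : {P : Set} → Dec P → ℤ
𝟙[ p? ] = if does p? then 1ℤ else 0ℤ

𝟙-⇔ : {P Q : Set} → P ⇔ Q → (p? : Dec P) (q? : Dec Q) → 𝟙[ p? ] ≡ 𝟙[ q? ]
𝟙-⇔ P⇔Q p? q? = cong (λ b → if b then 1ℤ else 0ℤ) (does-⇔ P⇔Q p? q?)

does-neg : ∀ a b → does (- a ≟ - b) ≡ does (a ≟ b)
does-neg a b = does-⇔ (mk⇔ ℤP.neg-injective (cong (λ z → - z))) (- a ≟ - b) (a ≟ b)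

𝟙-neg≟0 : ∀ a → 𝟙[ - a ≟ 0ℤ ] ≡ 𝟙[ a ≟ 0ℤ ]
𝟙-neg≟0 a = cong (λ b → if b then 1ℤ else 0ℤ) (does-neg a 0ℤ)

cong₃ : ∀ {A B C D : Set} (f : A → B → C → D) {a a′ b b′ c c′} →
        a ≡ a′ → b ≡ b′ → c ≡ c′ → f a b c ≡ f a′ b′ c′
cong₃ f refl refl refl = refl

twice : ℕ → ℕ
twice zero    = zero
twice (suc m) = suc (suc (twice m))

twice≡+ : ∀ m → twice m ≡ m ℕ.+ m
twice≡+ zero    = refl
twice≡+ (suc m) = cong suc (trans (cong suc (twice≡+ m)) (sym (ℕP.+-suc m m)))

twice-injective : ∀ {a b} → twice a ≡ twice b → a ≡ b
twice-injective {zero}  {zero}  _  = refl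
twice-injective {suc a} {suc b} eq = cong suc (twice-injective (ℕP.suc-injective (ℕP.suc-injective eq)))

sgn : ℤ → ℤ
sgn +0         = 0ℤ
sgn +[1+ _ ]   = 1ℤ
sgn -[1+ _ ]   = -1ℤ

sgn-neg : ∀ a → sgn (- a) ≡ - sgn a
sgn-neg +0       = refl
sgn-neg +[1+ _ ] = refl
sgn-neg -[1+ _ ] = refl

Σ±sgn : ℕ → ℤ → ℤ
Σ±sgn r a = Σ± r (λ x → sgn (a + sumℤ x))

Σ±sgn-assoc : ∀ r a b → Σ± r (λ x → sgn (a + (b + sumℤ x))) ≡ Σ±sgn r (a + b)
Σ±sgn-assoc r a b = Σ±-cong r (λ x _ → cong sgn (sym (ℤP.+-assoc a b (sumℤ x))))

Σ±sgn-suc : ∀ r a → Σ±sgn (suc r) a ≡ Σ±sgn r (a + 1ℤ) + Σ±sgn r (a - 1ℤ)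
Σ±sgn-suc r a = cong₂ _+_ (Σ±sgn-assoc r a 1ℤ) (Σ±sgn-assoc r a -1ℤ)

sgn-correlation : ∀ r a (i : Fin (suc r)) →
  Σ± (suc r) (λ u → sgn (a + sumℤ u) * lookup u i) ≡ Σ±sgn r (a + 1ℤ) - Σ±sgn r (a - 1ℤ)
sgn-correlation r a zero = cong₂ _+_
  (trans (Σ±-cong r (λ x _ → ℤP.*-identityʳ _)) (Σ±sgn-assoc r a 1ℤ))
  (begin
    Σ± r (λ x → sgn (a + (-1ℤ + sumℤ x)) * -1ℤ)
      ≡⟨ Σ±-cong r (λ x _ → trans (ℤP.*-comm _ -1ℤ) (ℤP.-1*i≡-i _)) ⟩
    Σ± r (λ x → - sgn (a + (-1ℤ + sumℤ x)))
      ≡⟨ Σ±-neg r (λ x → sgn (a + (-1ℤ + sumℤ x))) ⟩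
    - Σ± r (λ x → sgn (a + (-1ℤ + sumℤ x)))
      ≡⟨ cong -_ (Σ±sgn-assoc r a -1ℤ) ⟩
    - Σ±sgn r (a - 1ℤ) ∎)
  where open ≡-Reasoning
sgn-correlation (suc r) a (suc j) = begin
  Σ± (suc (suc r)) (λ u → sgn (a + sumℤ u) * lookup u (suc j))
    ≡⟨ cong₂ _+_ (regroup 1ℤ) (regroup -1ℤ) ⟩
  corr (a + 1ℤ) + corr (a - 1ℤ)
    ≡⟨ cong₂ _+_ (sgn-correlation r (a + 1ℤ) j) (sgn-correlation r (a - 1ℤ) j) ⟩
  (H (a + 1ℤ + 1ℤ) - H (a + 1ℤ - 1ℤ)) + (H (a - 1ℤ + 1ℤ) - H (a - 1ℤ - 1ℤ))
    ≡⟨ cong₂ (λ b c → (H (a + 1ℤ + 1ℤ) - H b) + (H c - H (a - 1ℤ - 1ℤ))) (+1-1 a) (-1+1 a) ⟩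
  (H (a + 1ℤ + 1ℤ) - H a) + (H a - H (a - 1ℤ - 1ℤ))
    ≡⟨ telescope (H (a + 1ℤ + 1ℤ)) (H a) (H (a - 1ℤ - 1ℤ)) ⟩
  (H (a + 1ℤ + 1ℤ) + H a) - (H a + H (a - 1ℤ - 1ℤ))
    ≡⟨ cong₂ (λ b c → (H (a + 1ℤ + 1ℤ) + H b) - (H c + H (a - 1ℤ - 1ℤ))) (+1-1 a) (-1+1 a) ⟨
  (H (a + 1ℤ + 1ℤ) + H (a + 1ℤ - 1ℤ)) - (H (a - 1ℤ + 1ℤ) + H (a - 1ℤ - 1ℤ))
    ≡⟨ cong₂ _-_ (Σ±sgn-suc r (a + 1ℤ)) (Σ±sgn-suc r (a - 1ℤ)) ⟨
  Σ±sgn (suc r) (a + 1ℤ) - Σ±sgn (suc r) (a - 1ℤ) ∎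
  where
  open ≡-Reasoning
  H : ℤ → ℤ
  H = Σ±sgn r
  corr : ℤ → ℤ
  corr b = Σ± (suc r) (λ x → sgn (b + sumℤ x) * lookup x j)
  regroup : ∀ b → Σ± (suc r) (λ x → sgn (a + (b + sumℤ x)) * lookup x j) ≡ corr (a + b)
  regroup b = Σ±-cong (suc r) (λ x _ → cong (λ s → sgn s * lookup x j) (sym (ℤP.+-assoc a b (sumℤ x))))
  +1-1 : ∀ a → a + 1ℤ - 1ℤ ≡ a
  +1-1 = solve-∀
  -1+1 : ∀ a → a - 1ℤ + 1ℤ ≡ a
  -1+1 = solve-∀
  telescope : ∀ p x q → (p - x) + (x - q) ≡ (p + x) - (x + q)
  telescope = solve-∀

#sum : ℕ → ℤ → ℤ
#sum r z = Σ± r (λ x → 𝟙[ sumℤ x ≟ z ])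

𝟙±1≤sgn-jump : ∀ c → 𝟙[ c ≟ -1ℤ ] + 𝟙[ c ≟ 1ℤ ] ℤ.≤ sgn (1ℤ + c) - sgn (-1ℤ + c)
𝟙±1≤sgn-jump +0                = ℤ.+≤+ ℕ.z≤n
𝟙±1≤sgn-jump +[1+ zero ]       = ℤP.≤-refl
𝟙±1≤sgn-jump +[1+ suc _ ]      = ℤP.≤-refl
𝟙±1≤sgn-jump -[1+ zero ]       = ℤP.≤-refl
𝟙±1≤sgn-jump -[1+ suc _ ]      = ℤP.≤-refl

majority-correlation-≥#sum : ∀ r (i : Fin (suc r)) →
  #sum r -1ℤ + #sum r 1ℤ ℤ.≤ Σ± (suc r) (λ u → sgn (sumℤ u) * lookup u i)
majority-correlation-≥#sum r i = begin
  #sum r -1ℤ + #sum r 1ℤ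
    ≡⟨ Σ±-distrib-+ r _ _ ⟨
  Σ± r (λ x → 𝟙[ sumℤ x ≟ -1ℤ ] + 𝟙[ sumℤ x ≟ 1ℤ ])
    ≤⟨ Σ±-mono-≤ r (λ x → 𝟙±1≤sgn-jump (sumℤ x)) ⟩
  Σ± r (λ x → sgn (1ℤ + sumℤ x) - sgn (-1ℤ + sumℤ x))
    ≡⟨ Σ±-distrib-+ r _ _ ⟩
  Σ±sgn r 1ℤ + Σ± r (λ x → - sgn (-1ℤ + sumℤ x))
    ≡⟨ cong (λ z → Σ±sgn r 1ℤ + z) (Σ±-neg r _) ⟩
  Σ±sgn r 1ℤ - Σ±sgn r -1ℤ
    ≡⟨ sgn-correlation r 0ℤ i ⟨
  Σ± (suc r) (λ u → sgn (0ℤ + sumℤ u) * lookup u i)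
    ≡⟨ Σ±-cong (suc r) (λ u _ → cong (λ s → sgn s * lookup u i) (ℤP.+-identityˡ (sumℤ u))) ⟩
  Σ± (suc r) (λ u → sgn (sumℤ u) * lookup u i) ∎
  where open ℤP.≤-Reasoning

#neg : ∀ {m} → Vec ℤ m → ℕ
#neg []             = 0
#neg (+ _ ∷ x)      = #neg x
#neg (-[1+ _ ] ∷ x) = suc (#neg x)

Σ±-#neg≡C : ∀ r j → Σ± r (λ x → 𝟙[ #neg x ℕ.≟ j ]) ≡ + (r C j)
Σ±-#neg≡C zero    zero    = refl
Σ±-#neg≡C zero    (suc j) = refl
Σ±-#neg≡C (suc r) zero    = trans (cong₂ _+_ (Σ±-#neg≡C r zero) (Σ±-zero r)) (ℤP.+-identityʳ _)
Σ±-#neg≡C (suc r) (suc j) = trans (cong₂ _+_ (Σ±-#neg≡C r (suc j)) (Σ±-#neg≡C r j))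
  (trans (ℤP.+-comm (+ (r C suc j)) (+ (r C j))) (cong +_ (nCk+nC[k+1]≡[n+1]C[k+1] r j)))

sumℤ≡len-twice#neg : ∀ {r} (x : Vec ℤ r) → IsSignVec x → sumℤ x ≡ + r - + twice (#neg x)
sumℤ≡len-twice#neg []      []               = refl
sumℤ≡len-twice#neg {suc r} (_ ∷ x) (inj₁ refl ∷ sx) =
  trans (cong (λ s → 1ℤ + s) (sumℤ≡len-twice#neg x sx)) (sym (ℤP.+-assoc 1ℤ (+ r) (- + twice (#neg x))))
sumℤ≡len-twice#neg (_ ∷ x) (inj₂ refl ∷ sx) =
  trans (cong (λ s → -1ℤ + s) (sumℤ≡len-twice#neg x sx)) (shuffle (+ _) (+ twice (#neg x)))
  where
  shuffle : ∀ r n → -1ℤ + (r - n) ≡ (1ℤ + r) - (1ℤ + (1ℤ + n))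
  shuffle = solve-∀

#sum-1≡C : ∀ h → #sum (suc (twice h)) -1ℤ ≡ + (suc (twice h) C suc h)
#sum-1≡C h = trans
  (Σ±-cong r (λ x sx → 𝟙-⇔ (sum≡-1⇔#neg≡ x sx) (sumℤ x ≟ -1ℤ) (#neg x ℕ.≟ suc h)))
  (Σ±-#neg≡C r (suc h))
  where
  r : ℕ
  r = suc (twice h)
  sum≡-1⇔#neg≡ : ∀ x → IsSignVec x → (sumℤ x ≡ -1ℤ) ⇔ (#neg x ≡ suc h)
  sum≡-1⇔#neg≡ x sx = mk⇔ to from
    where
    open ≡-Reasoning
    sum≡ : sumℤ x ≡ + r - + twice (#neg x)
    sum≡ = sumℤ≡len-twice#neg x sx
    to : sumℤ x ≡ -1ℤ → #neg x ≡ suc h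
    to s≡-1 = twice-injective (ℤP.+-injective (begin
      + twice (#neg x)                   ≡⟨ t≡r-[r-t] (+ r) (+ twice (#neg x)) ⟩
      + r - (+ r - + twice (#neg x))     ≡⟨ cong (λ s → + r - s) (trans (sym sum≡) s≡-1) ⟩
      + (r ℕ.+ 1)                        ≡⟨ cong +_ (ℕP.+-comm r 1) ⟩
      + twice (suc h)                    ∎))
      where
      t≡r-[r-t] : ∀ r t → t ≡ r - (r - t)
      t≡r-[r-t] = solve-∀
    from : #neg x ≡ suc h → sumℤ x ≡ -1ℤ
    from #neg≡ = trans sum≡ (trans (cong (λ n → + r - + twice n) #neg≡) (difference (+ twice h)))
      where
      difference : ∀ t → (1ℤ + t) - (1ℤ + (1ℤ + t)) ≡ -1ℤ
      difference = solve-∀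

#sum-sym : ∀ r → #sum r 1ℤ ≡ #sum r -1ℤ
#sum-sym r = trans (sym (Σ±-∘negate r (λ x → 𝟙[ sumℤ x ≟ 1ℤ ])))
  (Σ±-cong r (λ x _ → 𝟙-⇔ (mk⇔ (to x) (from x)) (sumℤ (negate x) ≟ 1ℤ) (sumℤ x ≟ -1ℤ)))
  where
  to : ∀ x → sumℤ (negate x) ≡ 1ℤ → sumℤ x ≡ -1ℤ
  to x e = trans (sym (ℤP.neg-involutive (sumℤ x))) (cong -_ (trans (sym (sumℤ-negate x)) e))
  from : ∀ x → sumℤ x ≡ -1ℤ → sumℤ (negate x) ≡ 1ℤ
  from x e = trans (sumℤ-negate x) (cong -_ e)

majority-correlation-≥2C : ∀ h (i : Fin (twice (suc h))) →
  let β = + (suc (twice h) C suc h) in β + β ℤ.≤ Σ± (twice (suc h)) (λ u → sgn (sumℤ u) * lookup u i)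
majority-correlation-≥2C h i = ℤP.≤-trans
  (ℤP.≤-reflexive (sym (cong₂ _+_ (#sum-1≡C h) (trans (#sum-sym (suc (twice h))) (#sum-1≡C h)))))
  (majority-correlation-≥#sum (suc (twice h)) i)

duplicate : ∀ {m} → Vec ℤ m → Vec ℤ (twice m)
duplicate []      = []
duplicate (a ∷ x) = a ∷ a ∷ duplicate x

halve : ∀ {m} → Vec ℤ (twice m) → Vec ℤ m
halve {zero}  []          = []
halve {suc m} (a ∷ _ ∷ w) = a ∷ halve w

duplicated? : ∀ {m} → Vec ℤ (twice m) → Bool
duplicated? {zero}  []          = true
duplicated? {suc m} (a ∷ b ∷ w) = does (a ≟ b) ∧ duplicated? w

half : ∀ {m} → Fin (twice m) → Fin m
half {suc m} zero          = zero
half {suc m} (suc zero)    = zero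
half {suc m} (suc (suc i)) = suc (half i)

sumℤ-duplicate : ∀ {m} (x : Vec ℤ m) → sumℤ (duplicate x) ≡ sumℤ x + sumℤ x
sumℤ-duplicate []      = refl
sumℤ-duplicate (a ∷ x) = trans (cong (λ s → a + (a + s)) (sumℤ-duplicate x)) (shuffle a (sumℤ x))
  where
  shuffle : ∀ a s → a + (a + (s + s)) ≡ (a + s) + (a + s)
  shuffle = solve-∀

halve-duplicate : ∀ {m} (x : Vec ℤ m) → halve (duplicate x) ≡ x
halve-duplicate []      = refl
halve-duplicate (a ∷ x) = cong (a ∷_) (halve-duplicate x)

lookup-duplicate : ∀ {m} (x : Vec ℤ m) (i : Fin (twice m)) → lookup (duplicate x) i ≡ lookup x (half i)
lookup-duplicate (a ∷ x) zero          = refl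
lookup-duplicate (a ∷ x) (suc zero)    = refl
lookup-duplicate (a ∷ x) (suc (suc i)) = lookup-duplicate x i

duplicated⇒≡duplicate : ∀ {m} (u : Vec ℤ (twice m)) → duplicated? u ≡ true → u ≡ duplicate (halve u)
duplicated⇒≡duplicate {zero}  []          _ = refl
duplicated⇒≡duplicate {suc m} (a ∷ b ∷ w) d with a ≟ b
... | yes refl = cong (λ z → a ∷ a ∷ z) (duplicated⇒≡duplicate w d)

duplicated?-negate : ∀ {m} (u : Vec ℤ (twice m)) → duplicated? (negate u) ≡ duplicated? u
duplicated?-negate {zero}  []          = refl
duplicated?-negate {suc m} (a ∷ b ∷ w) = cong₂ _∧_ (does-neg a b) (duplicated?-negate w)

halve-negate : ∀ {m} (u : Vec ℤ (twice m)) → halve (negate u) ≡ negate (halve u)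
halve-negate {zero}  []          = refl
halve-negate {suc m} (a ∷ b ∷ w) = cong (λ z → - a ∷ z) (halve-negate w)

𝟙≥2 : ℕ → ℤ
𝟙≥2 (suc (suc _)) = 1ℤ
𝟙≥2 _             = 0ℤ

-- Ψ s e k w reads w pair by pair: s is the sum of the entries read so far, k the number of
-- unequal pairs read so far (capped at 3), and e the leading entry of the first pair that is
-- equal or is the third unequal one.  The value is 𝟙[s + Σ w = 0] · x₁ · x₂ · e, where x₁ and x₂ lead the
-- first two unequal pairs; it is 0 when x₁, x₂ or e does not exist.
mutual
  Ψ : ∀ {r} → ℤ → Maybe ℤ → ℕ → Vec ℤ (twice r) → ℤ
  Ψ {zero}  s e k []          = 𝟙[ s ≟ 0ℤ ] * (fromMaybe 0ℤ e * 𝟙≥2 k)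
  Ψ {suc r} s e k (x ∷ y ∷ w) =
    if does (x ≟ y) then Ψ (s + (x + y)) (e <∣> just x) k w else Ψ≢ (s + (x + y)) e k x w

  Ψ≢ : ∀ {r} → ℤ → Maybe ℤ → ℕ → ℤ → Vec ℤ (twice r) → ℤ
  Ψ≢ s e zero                x w = x * Ψ s e 1 w
  Ψ≢ s e (suc zero)          x w = x * Ψ s e 2 w
  Ψ≢ s e (suc (suc zero))    x w = Ψ s (e <∣> just x) 3 w
  Ψ≢ s e (suc (suc (suc k))) x w = Ψ s e (suc (suc (suc k))) w

Ψ-[]≡0 : ∀ s e {k} → 𝟙≥2 k ≡ 0ℤ → Ψ s e k [] ≡ 0ℤ
Ψ-[]≡0 s e {k} 𝟙≥2k≡0 = begin
  𝟙[ s ≟ 0ℤ ] * (fromMaybe 0ℤ e * 𝟙≥2 k) ≡⟨ cong (λ z → 𝟙[ s ≟ 0ℤ ] * (E * z)) 𝟙≥2k≡0 ⟩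
  𝟙[ s ≟ 0ℤ ] * (fromMaybe 0ℤ e * 0ℤ)    ≡⟨ cong (λ z → 𝟙[ s ≟ 0ℤ ] * z) (ℤP.*-zeroʳ E) ⟩
  𝟙[ s ≟ 0ℤ ] * 0ℤ                       ≡⟨ ℤP.*-zeroʳ 𝟙[ s ≟ 0ℤ ] ⟩
  0ℤ                                     ∎
  where
  open ≡-Reasoning
  E : ℤ
  E = fromMaybe 0ℤ e

Ψ-duplicated : ∀ {r} s e (u : Vec ℤ (twice r)) → duplicated? u ≡ true → Ψ s e 0 u ≡ 0ℤ
Ψ-duplicated {zero}  s e []          _ = Ψ-[]≡0 s e {0} refl
Ψ-duplicated {suc r} s e (a ∷ b ∷ w) d with a ≟ b
... | yes refl = Ψ-duplicated _ _ w d

opposite-terms : ∀ {a b c d} → a ≡ 0ℤ → d ≡ 0ℤ → c ≡ - b → (a + b) + (c + d) ≡ 0ℤ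
opposite-terms {b = b} refl refl refl = cancel b
  where
  cancel : ∀ b → (0ℤ + b) + (- b + 0ℤ) ≡ 0ℤ
  cancel = solve-∀

Ψ≢-lead : ∀ {r} s e k x (w : Vec ℤ (twice r)) → k ℕ.< 2 → Ψ≢ s e k x w ≡ x * Ψ s e (suc k) w
Ψ≢-lead s e zero       x w _ = refl
Ψ≢-lead s e (suc zero) x w _ = refl
Ψ≢-lead s e (suc (suc k)) x w (ℕ.s≤s (ℕ.s≤s ()))

-- Swapping the entries of the first unequal pair negates Ψ.
Σ±Ψ≡0 : ∀ r s e k → k ℕ.< 2 → Σ± (twice r) (Ψ s e k) ≡ 0ℤ
Σ±Ψ≡0 zero    s e k k<2 = Ψ-[]≡0 s e (𝟙≥2-<2 k<2)
  where
  𝟙≥2-<2 : ∀ {k} → k ℕ.< 2 → 𝟙≥2 k ≡ 0ℤ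
  𝟙≥2-<2 (ℕ.s≤s ℕ.z≤n)          = refl
  𝟙≥2-<2 (ℕ.s≤s (ℕ.s≤s ℕ.z≤n)) = refl
Σ±Ψ≡0 (suc r) s e k k<2 = opposite-terms
  (Σ±Ψ≡0 r (s + + 2) (e <∣> just 1ℤ) k k<2)
  (Σ±Ψ≡0 r (s + -[1+ 1 ]) (e <∣> just -1ℤ) k k<2)
  (trans (Σ±-cong (twice r) (λ w _ → lead-flip w)) (Σ±-neg (twice r) (Ψ≢ (s + 0ℤ) e k 1ℤ)))
  where
  lead-flip : ∀ w → Ψ≢ (s + 0ℤ) e k -1ℤ w ≡ - Ψ≢ (s + 0ℤ) e k 1ℤ w
  lead-flip w = begin
    Ψ≢ (s + 0ℤ) e k -1ℤ w        ≡⟨ Ψ≢-lead (s + 0ℤ) e k -1ℤ w k<2 ⟩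
    -1ℤ * Ψ (s + 0ℤ) e (suc k) w ≡⟨ ℤP.-1*i≡-i _ ⟩
    - Ψ (s + 0ℤ) e (suc k) w     ≡⟨ cong (λ z → - z) (sym (ℤP.*-identityˡ _)) ⟩
    - (1ℤ * Ψ (s + 0ℤ) e (suc k) w) ≡⟨ cong (λ z → - z) (Ψ≢-lead (s + 0ℤ) e k 1ℤ w k<2) ⟨
    - Ψ≢ (s + 0ℤ) e k 1ℤ w       ∎
    where open ≡-Reasoning

Σ±Ψ₀-cons≡0 : ∀ r s e x y → Σ± (twice r) (λ w → Ψ s e 0 (x ∷ y ∷ w)) ≡ 0ℤ
Σ±Ψ₀-cons≡0 r s e x y with does (x ≟ y)
... | true  = Σ±Ψ≡0 r (s + (x + y)) (e <∣> just x) 0 (ℕ.s≤s ℕ.z≤n)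
... | false = begin
  Σ± (twice r) (λ w → x * Ψ (s + (x + y)) e 1 w) ≡⟨ Σ±-distribˡ-* (twice r) x (Ψ (s + (x + y)) e 1) ⟩
  x * Σ± (twice r) (Ψ (s + (x + y)) e 1)        ≡⟨ cong (x *_) (Σ±Ψ≡0 r _ e 1 (s≤s (s≤s z≤n))) ⟩
  x * 0ℤ                                         ≡⟨ ℤP.*-zeroʳ x ⟩
  0ℤ                                             ∎
  where open ≡-Reasoning

Σ±Ψ₀-cons-scaled≡0 : ∀ r s e x y c → Σ± (twice r) (λ w → Ψ s e 0 (x ∷ y ∷ w) * c) ≡ 0ℤ
Σ±Ψ₀-cons-scaled≡0 r s e x y c = begin
  Σ± (twice r) (λ w → Ψ s e 0 (x ∷ y ∷ w) * c) ≡⟨ Σ±-cong (twice r) (λ w _ → ℤP.*-comm _ c) ⟩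
  Σ± (twice r) (λ w → c * Ψ s e 0 (x ∷ y ∷ w)) ≡⟨ Σ±-distribˡ-* (twice r) c _ ⟩
  c * Σ± (twice r) (λ w → Ψ s e 0 (x ∷ y ∷ w)) ≡⟨ cong (λ z → c * z) (Σ±Ψ₀-cons≡0 r s e x y) ⟩
  c * 0ℤ                                        ≡⟨ ℤP.*-zeroʳ c ⟩
  0ℤ                                            ∎
  where open ≡-Reasoning

+-assoc-pair : ∀ s x y t → s + (x + (y + t)) ≡ (s + (x + y)) + t
+-assoc-pair = solve-∀

all-terms-zero : ∀ {a b c d} → a ≡ 0ℤ → b ≡ 0ℤ → c ≡ 0ℤ → d ≡ 0ℤ →
                 (a + b) + (c + d) ≡ 0ℤ
all-terms-zero refl refl refl refl = refl

-- Swapping the entries of the first unequal pair not containing coordinate i negates Ψ and keeps u_i.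
Ψ-correlation≡0 : ∀ r s e (i : Fin (twice r)) → Σ± (twice r) (λ w → Ψ s e 0 w * lookup w i) ≡ 0ℤ
Ψ-correlation≡0 (suc r) s e zero = all-terms-zero
  (Σ±Ψ₀-cons-scaled≡0 r s e 1ℤ 1ℤ 1ℤ)   (Σ±Ψ₀-cons-scaled≡0 r s e 1ℤ -1ℤ 1ℤ)
  (Σ±Ψ₀-cons-scaled≡0 r s e -1ℤ 1ℤ -1ℤ) (Σ±Ψ₀-cons-scaled≡0 r s e -1ℤ -1ℤ -1ℤ)
Ψ-correlation≡0 (suc r) s e (suc zero) = all-terms-zero
  (Σ±Ψ₀-cons-scaled≡0 r s e 1ℤ 1ℤ 1ℤ)   (Σ±Ψ₀-cons-scaled≡0 r s e 1ℤ -1ℤ -1ℤ)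
  (Σ±Ψ₀-cons-scaled≡0 r s e -1ℤ 1ℤ 1ℤ)  (Σ±Ψ₀-cons-scaled≡0 r s e -1ℤ -1ℤ -1ℤ)
Ψ-correlation≡0 (suc r) s e (suc (suc j)) = opposite-terms
  (Ψ-correlation≡0 r (s + + 2) (e <∣> just 1ℤ) j)
  (Ψ-correlation≡0 r (s + -[1+ 1 ]) (e <∣> just -1ℤ) j)
  (trans (Σ±-cong (twice r) (λ w _ → lead-flip (Ψ (s + 0ℤ) e 1 w) (lookup w j)))
         (Σ±-neg (twice r) (λ w → (1ℤ * Ψ (s + 0ℤ) e 1 w) * lookup w j)))
  where
  lead-flip : ∀ p l → (-1ℤ * p) * l ≡ - ((1ℤ * p) * l)
  lead-flip = solve-∀

neg-distrib³ : ∀ s x y → - s + (- x + - y) ≡ - (s + (x + y))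
neg-distrib³ = solve-∀

fromMaybe-neg : ∀ e → fromMaybe 0ℤ (Maybe.map (λ a → - a) e) ≡ - fromMaybe 0ℤ e
fromMaybe-neg nothing  = refl
fromMaybe-neg (just a) = refl

-- (-1) ^ (1 + the number of the factors x₁, x₂ not yet read)
oddSign : ℕ → ℤ
oddSign (suc zero) = 1ℤ
oddSign _          = -1ℤ

mutual
  Ψ-odd : ∀ {r} s e k (w : Vec ℤ (twice r)) →
          Ψ (- s) (Maybe.map (λ a → - a) e) k (negate w) ≡ oddSign k * Ψ s e k w
  Ψ-odd {zero} s e zero [] = trans (Ψ-[]≡0 (- s) (Maybe.map (λ a → - a) e) {0} refl)
                                   (sym (cong (λ z → -1ℤ * z) (Ψ-[]≡0 s e {0} refl)))
  Ψ-odd {zero} s e (suc zero) [] = trans (Ψ-[]≡0 (- s) (Maybe.map (λ a → - a) e) {1} refl)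
                                         (sym (cong (λ z → 1ℤ * z) (Ψ-[]≡0 s e {1} refl)))
  Ψ-odd {zero} s e (suc (suc k)) [] = begin
    𝟙[ - s ≟ 0ℤ ] * (fromMaybe 0ℤ (Maybe.map (λ a → - a) e) * 1ℤ)
      ≡⟨ cong₂ (λ a b → a * (b * 1ℤ)) (𝟙-neg≟0 s) (fromMaybe-neg e) ⟩
    𝟙[ s ≟ 0ℤ ] * (- fromMaybe 0ℤ e * 1ℤ)
      ≡⟨ pull-sign 𝟙[ s ≟ 0ℤ ] (fromMaybe 0ℤ e) ⟩
    -1ℤ * (𝟙[ s ≟ 0ℤ ] * (fromMaybe 0ℤ e * 1ℤ)) ∎
    where
    open ≡-Reasoning
    pull-sign : ∀ i f → i * (- f * 1ℤ) ≡ -1ℤ * (i * (f * 1ℤ))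
    pull-sign = solve-∀
  Ψ-odd {suc r} s e k (x ∷ y ∷ w) rewrite does-neg x y with does (x ≟ y)
  ... | true  = trans (cong₂ (λ s′ e′ → Ψ s′ e′ k (negate w)) (neg-distrib³ s x y)
                             (sym (map-<∣> (λ a → - a) e (just x))))
                      (Ψ-odd (s + (x + y)) (e <∣> just x) k w)
  ... | false = trans (cong (λ s′ → Ψ≢ s′ (Maybe.map (λ a → - a) e) k (- x) (negate w))
                            (neg-distrib³ s x y))
                      (Ψ≢-odd (s + (x + y)) e k x w)

  Ψ≢-odd : ∀ {r} s e k x (w : Vec ℤ (twice r)) →
           Ψ≢ (- s) (Maybe.map (λ a → - a) e) k (- x) (negate w) ≡ oddSign k * Ψ≢ s e k x w
  Ψ≢-odd s e zero x w = trans (cong (λ z → - x * z) (Ψ-odd s e 1 w)) (shuffle x (Ψ s e 1 w))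
    where
    shuffle : ∀ x p → - x * (1ℤ * p) ≡ -1ℤ * (x * p)
    shuffle = solve-∀
  Ψ≢-odd s e (suc zero) x w = trans (cong (λ z → - x * z) (Ψ-odd s e 2 w)) (shuffle x (Ψ s e 2 w))
    where
    shuffle : ∀ x p → - x * (-1ℤ * p) ≡ 1ℤ * (x * p)
    shuffle = solve-∀
  Ψ≢-odd s e (suc (suc zero)) x w =
    trans (cong (λ e′ → Ψ (- s) e′ 3 (negate w)) (sym (map-<∣> (λ a → - a) e (just x))))
          (Ψ-odd s (e <∣> just x) 3 w)
  Ψ≢-odd s e (suc (suc (suc k))) x w = Ψ-odd s e (suc (suc (suc k))) w

𝟙-idem : ∀ {P : Set} (p? : Dec P) a → 𝟙[ p? ] * (𝟙[ p? ] * a) ≡ 𝟙[ p? ] * a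
𝟙-idem (yes _) a = ℤP.*-identityˡ (1ℤ * a)
𝟙-idem (no _)  a = refl

𝟙*Ψ≡Ψ : ∀ {r} s e k (w : Vec ℤ (twice r)) → 𝟙[ s + sumℤ w ≟ 0ℤ ] * Ψ s e k w ≡ Ψ s e k w
𝟙*Ψ≡Ψ {zero} s e k [] =
  trans (cong (λ z → 𝟙[ z ≟ 0ℤ ] * Ψ s e k []) (ℤP.+-identityʳ s)) (𝟙-idem (s ≟ 0ℤ) _)
𝟙*Ψ≡Ψ {suc r} s e k (x ∷ y ∷ w) with does (x ≟ y)
... | true  = trans (cong (λ z → 𝟙[ z ≟ 0ℤ ] * Ψ t (e <∣> just x) k w) (+-assoc-pair s x y (sumℤ w)))
                    (𝟙*Ψ≡Ψ t (e <∣> just x) k w)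
  where
  t : ℤ
  t = s + (x + y)
... | false = trans (cong (λ z → 𝟙[ z ≟ 0ℤ ] * Ψ≢ t e k x w) (+-assoc-pair s x y (sumℤ w)))
                    (𝟙*Ψ≢ k)
  where
  t : ℤ
  t = s + (x + y)
  𝟙*-lead : ∀ k → 𝟙[ t + sumℤ w ≟ 0ℤ ] * (x * Ψ t e k w) ≡ x * Ψ t e k w
  𝟙*-lead k = trans (swap 𝟙[ t + sumℤ w ≟ 0ℤ ] x (Ψ t e k w))
                    (cong (λ z → x * z) (𝟙*Ψ≡Ψ t e k w))
    where
    swap : ∀ a b c → a * (b * c) ≡ b * (a * c)
    swap = solve-∀
  𝟙*Ψ≢ : ∀ k → 𝟙[ t + sumℤ w ≟ 0ℤ ] * Ψ≢ t e k x w ≡ Ψ≢ t e k x w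
  𝟙*Ψ≢ zero                = 𝟙*-lead 1
  𝟙*Ψ≢ (suc zero)          = 𝟙*-lead 2
  𝟙*Ψ≢ (suc (suc zero))    = 𝟙*Ψ≡Ψ t (e <∣> just x) 3 w
  𝟙*Ψ≢ (suc (suc (suc k))) = 𝟙*Ψ≡Ψ t e (suc (suc (suc k))) w

#unequal : ∀ {r} → Vec ℤ (twice r) → ℕ
#unequal {zero}  []          = 0
#unequal {suc r} (x ∷ y ∷ w) = if does (x ≟ y) then #unequal w else suc (#unequal w)

#unequal≤ : ∀ {r} (w : Vec ℤ (twice r)) → #unequal w ≤ r
#unequal≤ {zero}  []          = z≤n
#unequal≤ {suc r} (x ∷ y ∷ w) with does (x ≟ y)
... | true  = ℕP.m≤n⇒m≤1+n (#unequal≤ w)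
... | false = s≤s (#unequal≤ w)

1≤#unequal : ∀ {r} (w : Vec ℤ (twice r)) → duplicated? w ≡ false → 1 ≤ #unequal w
1≤#unequal {zero}  []          ()
1≤#unequal {suc r} (x ∷ y ∷ w) d with does (x ≟ y)
... | true  = 1≤#unequal w d
... | false = s≤s z≤n

-- a and b count the pairs (1, 1) and (-1, -1).
equal-pair-counts : ∀ {r} (w : Vec ℤ (twice r)) → IsSignVec w →
  ∃₂ λ a b → r ≡ #unequal w ℕ.+ (a ℕ.+ b) × sumℤ w ≡ + twice a - + twice b
equal-pair-counts {zero} [] [] = 0 , 0 , refl , refl
equal-pair-counts {suc r} (_ ∷ _ ∷ w) (inj₁ refl ∷ inj₁ refl ∷ sw) with equal-pair-counts w sw
... | a , b , r≡ , s≡ = suc a , b , trans (cong suc r≡) (sym (ℕP.+-suc _ _)) ,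
  trans (cong (λ z → 1ℤ + (1ℤ + z)) s≡) (shuffle (+ twice a) (+ twice b))
  where
  shuffle : ∀ p n → 1ℤ + (1ℤ + (p - n)) ≡ (1ℤ + (1ℤ + p)) - n
  shuffle = solve-∀
equal-pair-counts {suc r} (_ ∷ _ ∷ w) (inj₂ refl ∷ inj₂ refl ∷ sw) with equal-pair-counts w sw
... | a , b , r≡ , s≡ = a , suc b ,
  trans (cong suc r≡) (trans (sym (ℕP.+-suc _ _)) (cong (#unequal w ℕ.+_) (sym (ℕP.+-suc a b)))) ,
  trans (cong (λ z → -1ℤ + (-1ℤ + z)) s≡) (shuffle (+ twice a) (+ twice b))
  where
  shuffle : ∀ p n → -1ℤ + (-1ℤ + (p - n)) ≡ p - (1ℤ + (1ℤ + n))
  shuffle = solve-∀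
equal-pair-counts {suc r} (_ ∷ _ ∷ w) (inj₁ refl ∷ inj₂ refl ∷ sw) with equal-pair-counts w sw
... | a , b , r≡ , s≡ =
  a , b , cong suc r≡ , trans (cong (λ z → 1ℤ + (-1ℤ + z)) s≡) (shuffle (+ twice a - + twice b))
  where
  shuffle : ∀ d → 1ℤ + (-1ℤ + d) ≡ d
  shuffle = solve-∀
equal-pair-counts {suc r} (_ ∷ _ ∷ w) (inj₂ refl ∷ inj₁ refl ∷ sw) with equal-pair-counts w sw
... | a , b , r≡ , s≡ =
  a , b , cong suc r≡ , trans (cong (λ z → -1ℤ + (1ℤ + z)) s≡) (shuffle (+ twice a - + twice b))
  where
  shuffle : ∀ d → -1ℤ + (1ℤ + d) ≡ d
  shuffle = solve-∀

IsSign-* : ∀ {a b} → IsSign a → IsSign b → IsSign (a * b)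
IsSign-* (inj₁ refl) (inj₁ refl) = inj₁ refl
IsSign-* (inj₁ refl) (inj₂ refl) = inj₂ refl
IsSign-* (inj₂ refl) (inj₁ refl) = inj₂ refl
IsSign-* (inj₂ refl) (inj₂ refl) = inj₁ refl

is-just-<∣>just : ∀ (e : Maybe ℤ) x → Is-just (e <∣> just x)
is-just-<∣>just nothing  x = just _
is-just-<∣>just (just a) x = just _

All-<∣>just : ∀ {e : Maybe ℤ} {x} → MaybeAll.All IsSign e → IsSign x → MaybeAll.All IsSign (e <∣> just x)
All-<∣>just nothing  sx = just sx
All-<∣>just (just sa) _ = just sa

-- e is known, or among the r remaining pairs, q of them unequal, there is an equal pair (q < r) or
-- a third unequal pair.
Settles : Maybe ℤ → (k q r : ℕ) → Set
Settles e k q r = Is-just e ⊎ q < r ⊎ (3 ≤ k ℕ.+ q × k ≤ 2)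

Settles-step : ∀ {e k k′ q r} → (3 ≤ k ℕ.+ suc q → k ≤ 2 → 3 ≤ k′ ℕ.+ q × k′ ≤ 2) →
  Settles e k (suc q) (suc r) → Settles e k′ q r
Settles-step f (inj₁ e-just)         = inj₁ e-just
Settles-step f (inj₂ (inj₁ q<r))     = inj₂ (inj₁ (ℕ.s≤s⁻¹ q<r))
Settles-step f (inj₂ (inj₂ (3≤ , k≤2))) = inj₂ (inj₂ (f 3≤ k≤2))

mutual
  Ψ-sign : ∀ {r} s e k (w : Vec ℤ (twice r)) → IsSignVec w → s + sumℤ w ≡ 0ℤ →
           2 ≤ k ℕ.+ #unequal w → Settles e k (#unequal w) r → MaybeAll.All IsSign e → IsSign (Ψ s e k w)
  Ψ-sign {zero} s e zero       [] [] _ () _ _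
  Ψ-sign {zero} s e (suc zero) [] [] _ (s≤s ()) _ _
  Ψ-sign {zero} s (just a) (suc (suc k)) [] [] bal _ _ (just sa) =
    subst IsSign (sym (begin
      𝟙[ s ≟ 0ℤ ] * (a * 1ℤ)  ≡⟨ cong (λ z → 𝟙[ z ≟ 0ℤ ] * (a * 1ℤ)) s≡0 ⟩
      1ℤ * (a * 1ℤ)           ≡⟨ ℤP.*-identityˡ (a * 1ℤ) ⟩
      a * 1ℤ                  ≡⟨ ℤP.*-identityʳ a ⟩
      a                       ∎)) sa
    where
    open ≡-Reasoning
    s≡0 : s ≡ 0ℤ
    s≡0 = trans (sym (ℤP.+-identityʳ s)) bal
  Ψ-sign {zero} s nothing (suc (suc zero)) [] [] _ _ (inj₂ (inj₂ (s≤s (s≤s ()) , _))) _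
  Ψ-sign {zero} s nothing (suc (suc (suc k))) [] [] _ _ (inj₂ (inj₂ (_ , s≤s (s≤s ())))) _
  Ψ-sign {suc r} s e k (x ∷ y ∷ w) (sx ∷ sy ∷ sw) bal two settles se with x ≟ y
  ... | yes refl = Ψ-sign (s + (x + x)) (e <∣> just x) k w sw (trans (sym (+-assoc-pair s x x (sumℤ w))) bal)
                          two (inj₁ (is-just-<∣>just e x)) (All-<∣>just se sx)
  ... | no _     = Ψ≢-sign (s + (x + y)) e k x w sx sw (trans (sym (+-assoc-pair s x y (sumℤ w))) bal)
                           two settles se

  Ψ≢-sign : ∀ {r} t e k x (w : Vec ℤ (twice r)) → IsSign x → IsSignVec w → t + sumℤ w ≡ 0ℤ →
            2 ≤ k ℕ.+ suc (#unequal w) → Settles e k (suc (#unequal w)) (suc r) → MaybeAll.All IsSign e →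
            IsSign (Ψ≢ t e k x w)
  Ψ≢-sign t e zero x w sx sw bal two settles se =
    IsSign-* sx (Ψ-sign t e 1 w sw bal two (Settles-step (λ 3≤ _ → 3≤ , s≤s z≤n) settles) se)
  Ψ≢-sign t e (suc zero) x w sx sw bal _ settles se =
    IsSign-* sx (Ψ-sign t e 2 w sw bal (s≤s (s≤s z≤n))
                        (Settles-step (λ 3≤ _ → 3≤ , s≤s (s≤s z≤n)) settles) se)
  Ψ≢-sign t e (suc (suc zero)) x w sx sw bal _ _ se =
    Ψ-sign t (e <∣> just x) 3 w sw bal (s≤s (s≤s z≤n)) (inj₁ (is-just-<∣>just e x)) (All-<∣>just se sx)
  Ψ≢-sign t e (suc (suc (suc k))) x w sx sw bal _ settles se =
    Ψ-sign t e (suc (suc (suc k))) w sw bal (s≤s (s≤s z≤n))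
           (Settles-step (λ { _ (s≤s (s≤s ())) }) settles) se

twice≢1+twice : ∀ m a → twice m ≢ suc (twice a)
twice≢1+twice zero    a       ()
twice≢1+twice (suc m) zero    ()
twice≢1+twice (suc m) (suc a) eq = twice≢1+twice m a (ℕP.suc-injective (ℕP.suc-injective eq))

-- In a balanced vector the pairs (1, 1) and (-1, -1) are equally many, so the number of unequal
-- pairs is even; it is positive unless the vector is duplicated.
Ψ₀-sign : ∀ {m} → 2 ≤ m → (u : Vec ℤ (twice (twice m))) → IsSignVec u → sumℤ u ≡ 0ℤ →
          duplicated? u ≡ false → IsSign (Ψ 0ℤ nothing 0 u)
Ψ₀-sign {m} 2≤m u su bal dup with equal-pair-counts u su
... | a , b , r≡ , s≡ = Ψ-sign 0ℤ nothing 0 u su (trans (ℤP.+-identityˡ (sumℤ u)) bal) 2≤q settles nothing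
  where
  a≡b : a ≡ b
  a≡b = twice-injective (ℤP.+-injective (ℤP.i-j≡0⇒i≡j _ _ (trans (sym s≡) bal)))
  r≡q+twice-a : twice m ≡ #unequal u ℕ.+ twice a
  r≡q+twice-a = trans r≡ (cong (#unequal u ℕ.+_) (trans (cong (a ℕ.+_) (sym a≡b)) (sym (twice≡+ a))))
  2≤q : 2 ≤ #unequal u
  2≤q with #unequal u | 1≤#unequal u dup | r≡q+twice-a
  ... | suc zero    | _ | r≡1+twice-a = ⊥-elim (twice≢1+twice m a r≡1+twice-a)
  ... | suc (suc _) | _ | _           = s≤s (s≤s z≤n)
  3≤twice : ∀ {m} → 2 ≤ m → 3 ≤ twice m
  3≤twice (s≤s (s≤s _)) = s≤s (s≤s (s≤s z≤n))
  settles : Settles nothing 0 (#unequal u) (twice m)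
  settles with ℕP.m≤n⇒m<n∨m≡n (#unequal≤ u)
  ... | inj₁ q<r = inj₂ (inj₁ q<r)
  ... | inj₂ q≡r = inj₂ (inj₂ (subst (3 ≤_) (sym q≡r) (3≤twice 2≤m) , z≤n))

record TieBreaker (n : ℕ) : Set where
  field
    tb             : Vec ℤ n → ℤ
    tb-odd         : ∀ u → tb (negate u) ≡ - tb u
    tb-sign        : ∀ u → IsSignVec u → sumℤ u ≡ 0ℤ → IsSign (tb u)
    tb-correlation : ∀ i → -[1+ 1 ] ℤ.≤ Σ± n (λ u → (𝟙[ sumℤ u ≟ 0ℤ ] * tb u) * lookup u i)

head-tieBreaker₂ : TieBreaker 2
head-tieBreaker₂ = record
  { tb             = head
  ; tb-odd         = λ { (a ∷ b ∷ []) → refl }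
  ; tb-sign        = λ { (a ∷ b ∷ []) (sa ∷ _) _ → sa }
  ; tb-correlation = λ { zero → ℤ.-≤+ ; (suc zero) → ℤP.≤-refl }
  }

head-tieBreaker₄ : TieBreaker 4
head-tieBreaker₄ = record
  { tb             = head
  ; tb-odd         = λ { (a ∷ b ∷ c ∷ d ∷ []) → refl }
  ; tb-sign        = λ { (a ∷ b ∷ c ∷ d ∷ []) (sa ∷ _) _ → sa }
  ; tb-correlation = λ { zero → ℤ.-≤+ ; (suc zero) → ℤP.≤-refl ; (suc (suc zero)) → ℤP.≤-refl
                       ; (suc (suc (suc zero))) → ℤP.≤-refl }
  }

x+x≡0⇒x≡0 : ∀ x → x + x ≡ 0ℤ → x ≡ 0ℤ
x+x≡0⇒x≡0 +0 _ = refl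

halve-IsSignVec : ∀ {m} (u : Vec ℤ (twice m)) → IsSignVec u → IsSignVec (halve u)
halve-IsSignVec {zero}  []          []               = []
halve-IsSignVec {suc m} (a ∷ b ∷ w) (sa ∷ _ ∷ sw) = sa ∷ halve-IsSignVec w sw

Σ±-duplicated : ∀ m (G : Vec ℤ (twice m) → ℤ) →
  Σ± (twice m) (λ u → if duplicated? u then G u else 0ℤ) ≡ Σ± m (λ x → G (duplicate x))
Σ±-duplicated zero    G = refl
Σ±-duplicated (suc m) G = begin
  (Σ± (twice m) (λ w → if duplicated? w then G (1ℤ ∷ 1ℤ ∷ w) else 0ℤ) + Z) +
  (Z + Σ± (twice m) (λ w → if duplicated? w then G (-1ℤ ∷ -1ℤ ∷ w) else 0ℤ))
    ≡⟨ cong₂ (λ a b → (a + Z) + (Z + b))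
             (Σ±-duplicated m (λ w → G (1ℤ ∷ 1ℤ ∷ w))) (Σ±-duplicated m (λ w → G (-1ℤ ∷ -1ℤ ∷ w))) ⟩
  (A + Z) + (Z + B)
    ≡⟨ cong (λ z → (A + z) + (z + B)) (Σ±-zero (twice m)) ⟩
  (A + 0ℤ) + (0ℤ + B)
    ≡⟨ cong₂ _+_ (ℤP.+-identityʳ A) (ℤP.+-identityˡ B) ⟩
  A + B ∎
  where
  open ≡-Reasoning
  Z A B : ℤ
  Z = Σ± (twice m) (λ _ → 0ℤ)
  A = Σ± m (λ x → G (1ℤ ∷ 1ℤ ∷ duplicate x))
  B = Σ± m (λ x → G (-1ℤ ∷ -1ℤ ∷ duplicate x))

-- Ψ is uncorrelated with every coordinate, so the correlations of t are those of T.
tieBreaker-double : ∀ {m} → 2 ≤ m → TieBreaker (twice m) → TieBreaker (twice (twice m))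
tieBreaker-double {m} 2≤m T = record
  { tb             = t
  ; tb-odd         = t-odd
  ; tb-sign        = t-sign
  ; tb-correlation = t-correlation
  }
  where
  open TieBreaker T
  n : ℕ
  n = twice (twice m)

  t : Vec ℤ n → ℤ
  t u = if duplicated? u then tb (halve u) else Ψ 0ℤ nothing 0 u

  t-odd : ∀ u → t (negate u) ≡ - t u
  t-odd u rewrite duplicated?-negate u with duplicated? u
  ... | true  = trans (cong tb (halve-negate u)) (tb-odd (halve u))
  ... | false = trans (Ψ-odd 0ℤ nothing 0 u) (ℤP.-1*i≡-i _)

  t-sign : ∀ u → IsSignVec u → sumℤ u ≡ 0ℤ → IsSign (t u)
  t-sign u su bal with duplicated? u in dup
  ... | true  = tb-sign (halve u) (halve-IsSignVec u su) (x+x≡0⇒x≡0 _ (begin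
        sumℤ (halve u) + sumℤ (halve u) ≡⟨ sumℤ-duplicate (halve u) ⟨
        sumℤ (duplicate (halve u))      ≡⟨ cong sumℤ (duplicated⇒≡duplicate u dup) ⟨
        sumℤ u                          ≡⟨ bal ⟩
        0ℤ                              ∎))
    where open ≡-Reasoning
  ... | false = Ψ₀-sign 2≤m u su bal dup

  module _ (i : Fin n) where
    G : Vec ℤ n → ℤ
    G u = (𝟙[ sumℤ u ≟ 0ℤ ] * tb (halve u)) * lookup u i

    split : ∀ u → (𝟙[ sumℤ u ≟ 0ℤ ] * t u) * lookup u i
                  ≡ (if duplicated? u then G u else 0ℤ) + Ψ 0ℤ nothing 0 u * lookup u i
    split u with duplicated? u in dup
    ... | true  = sym (trans (cong (λ z → G u + z * lookup u i) (Ψ-duplicated 0ℤ nothing u dup))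
                             (ℤP.+-identityʳ (G u)))
    ... | false = begin
      (𝟙[ sumℤ u ≟ 0ℤ ] * Ψ 0ℤ nothing 0 u) * lookup u i
        ≡⟨ cong (λ s → (𝟙[ s ≟ 0ℤ ] * Ψ 0ℤ nothing 0 u) * lookup u i) (ℤP.+-identityˡ (sumℤ u)) ⟨
      (𝟙[ 0ℤ + sumℤ u ≟ 0ℤ ] * Ψ 0ℤ nothing 0 u) * lookup u i
        ≡⟨ cong (λ z → z * lookup u i) (𝟙*Ψ≡Ψ 0ℤ nothing 0 u) ⟩
      Ψ 0ℤ nothing 0 u * lookup u i
        ≡⟨ ℤP.+-identityˡ _ ⟨
      0ℤ + Ψ 0ℤ nothing 0 u * lookup u i ∎
      where open ≡-Reasoning

    G∘duplicate : ∀ x → G (duplicate x) ≡ (𝟙[ sumℤ x ≟ 0ℤ ] * tb x) * lookup x (half i)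
    G∘duplicate x = cong₃ (λ a b c → (a * tb b) * c)
      (trans (cong (λ s → 𝟙[ s ≟ 0ℤ ]) (sumℤ-duplicate x))
             (𝟙-⇔ (mk⇔ (x+x≡0⇒x≡0 (sumℤ x)) (cong (λ z → z + z)))
                  (sumℤ x + sumℤ x ≟ 0ℤ) (sumℤ x ≟ 0ℤ)))
      (halve-duplicate x)
      (lookup-duplicate x i)

    t-correlation : -[1+ 1 ] ℤ.≤ Σ± n (λ u → (𝟙[ sumℤ u ≟ 0ℤ ] * t u) * lookup u i)
    t-correlation = begin
      -[1+ 1 ]
        ≤⟨ tb-correlation (half i) ⟩
      Σ± (twice m) (λ x → (𝟙[ sumℤ x ≟ 0ℤ ] * tb x) * lookup x (half i))
        ≡⟨ Σ±-cong (twice m) (λ x _ → G∘duplicate x) ⟨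
      Σ± (twice m) (λ x → G (duplicate x))
        ≡⟨ ℤP.+-identityʳ _ ⟨
      Σ± (twice m) (λ x → G (duplicate x)) + 0ℤ
        ≡⟨ cong₂ _+_ (Σ±-duplicated (twice m) G) (Ψ-correlation≡0 (twice m) 0ℤ nothing i) ⟨
      Σ± n (λ u → if duplicated? u then G u else 0ℤ) + Σ± n (λ u → Ψ 0ℤ nothing 0 u * lookup u i)
        ≡⟨ Σ±-distrib-+ n _ _ ⟨
      Σ± n (λ u → (if duplicated? u then G u else 0ℤ) + Ψ 0ℤ nothing 0 u * lookup u i)
        ≡⟨ Σ±-cong n (λ u _ → split u) ⟨
      Σ± n (λ u → (𝟙[ sumℤ u ≟ 0ℤ ] * t u) * lookup u i) ∎
      where open ℤP.≤-Reasoning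

pow2 : ℕ → ℕ
pow2 zero    = 1
pow2 (suc k) = twice (pow2 k)

pow2-positive : ∀ k → ∃ λ h → pow2 k ≡ suc h
pow2-positive zero    = 0 , refl
pow2-positive (suc k) with pow2-positive k
... | h , eq = suc (twice h) , cong twice eq

pow2≡2^ : ∀ k → pow2 k ≡ 2 ℕ.^ k
pow2≡2^ zero    = refl
pow2≡2^ (suc k) = trans (twice≡+ (pow2 k)) (trans (cong (λ p → p ℕ.+ p) (pow2≡2^ k))
                                                  (cong (2 ℕ.^ k ℕ.+_) (sym (ℕP.+-identityʳ (2 ℕ.^ k)))))

tieBreaker : ∀ k → TieBreaker (pow2 (suc k))
tieBreaker zero          = head-tieBreaker₂
tieBreaker (suc zero)    = head-tieBreaker₄
tieBreaker (suc (suc k)) = tieBreaker-double 2≤pow2 (tieBreaker (suc k))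
  where
  2≤pow2 : 2 ≤ pow2 (suc k)
  2≤pow2 with pow2-positive k
  ... | h , eq rewrite eq = s≤s (s≤s z≤n)

vote : ∀ {n} → TieBreaker n → Vec ℤ n → ℤ
vote T u = sgn (sumℤ u) + 𝟙[ sumℤ u ≟ 0ℤ ] * TieBreaker.tb T u

module _ {n} (T : TieBreaker n) where
  open TieBreaker T

  vote-odd : ∀ u → vote T (negate u) ≡ - vote T u
  vote-odd u = begin
    sgn (sumℤ (negate u)) + 𝟙[ sumℤ (negate u) ≟ 0ℤ ] * tb (negate u)
      ≡⟨ cong₂ (λ s t → sgn s + 𝟙[ s ≟ 0ℤ ] * t) (sumℤ-negate u) (tb-odd u) ⟩
    sgn (- sumℤ u) + 𝟙[ - sumℤ u ≟ 0ℤ ] * - tb u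
      ≡⟨ cong₂ (λ a b → a + b * - tb u) (sgn-neg (sumℤ u)) (𝟙-neg≟0 (sumℤ u)) ⟩
    - sgn (sumℤ u) + 𝟙[ sumℤ u ≟ 0ℤ ] * - tb u
      ≡⟨ pull-neg (sgn (sumℤ u)) 𝟙[ sumℤ u ≟ 0ℤ ] (tb u) ⟩
    - (sgn (sumℤ u) + 𝟙[ sumℤ u ≟ 0ℤ ] * tb u) ∎
    where
    open ≡-Reasoning
    pull-neg : ∀ a b c → - a + b * - c ≡ - (a + b * c)
    pull-neg = solve-∀

  vote-sign : ∀ u → IsSignVec u → IsSign (vote T u)
  vote-sign u su with sumℤ u in bal
  ... | +0       = subst IsSign (sym (trans (ℤP.+-identityˡ _) (ℤP.*-identityˡ (tb u)))) (tb-sign u su bal)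
  ... | +[1+ _ ] = inj₁ refl
  ... | -[1+ _ ] = inj₂ refl

Σ±-even : ∀ r (G : Vec ℤ (suc r) → ℤ) → (∀ u → G (negate u) ≡ G u) →
  Σ± (suc r) G ≡ Σ± r (λ x → G (1ℤ ∷ x)) + Σ± r (λ x → G (1ℤ ∷ x))
Σ±-even r G G-even = cong (λ z → Σ± r (λ x → G (1ℤ ∷ x)) + z)
  (trans (sym (Σ±-∘negate r (λ x → G (-1ℤ ∷ x)))) (Σ±-cong r (λ x _ → G-even (1ℤ ∷ x))))

halve-≤ : ∀ c d → (c + c) - + 2 ℤ.≤ d + d → c - 1ℤ ℤ.≤ d
halve-≤ c d c+c-2≤d+d =
  ℤP.*-cancelˡ-≤-pos (c - 1ℤ) d (+ 2) (subst₂ ℤ._≤_ (double-1 c) (double d) c+c-2≤d+d)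
  where
  double-1 : ∀ c → c + c - + 2 ≡ + 2 * (c - 1ℤ)
  double-1 = solve-∀
  double : ∀ d → d + d ≡ + 2 * d
  double = solve-∀

module _ (h : ℕ) (T : TieBreaker (twice (suc h))) where
  open TieBreaker T

  private
    r : ℕ
    r = suc (twice h)
    β : ℤ
    β = + (r C suc h)

  vote-correlation-≥ : ∀ i → (β + β) - + 2 ℤ.≤ Σ± (suc r) (λ u → vote T u * lookup u i)
  vote-correlation-≥ i = begin
    (β + β) + -[1+ 1 ]                       ≤⟨ ℤP.+-mono-≤ (majority-correlation-≥2C h i) (tb-correlation i) ⟩
    Σ± (suc r) majority + Σ± (suc r) tie      ≡⟨ Σ±-distrib-+ (suc r) majority tie ⟨
    Σ± (suc r) (λ u → majority u + tie u)     ≡⟨ Σ±-cong (suc r) (λ u _ → split u) ⟨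
    Σ± (suc r) (λ u → vote T u * lookup u i) ∎
    where
    open ℤP.≤-Reasoning
    majority tie : Vec ℤ (suc r) → ℤ
    majority u = sgn (sumℤ u) * lookup u i
    tie u = (𝟙[ sumℤ u ≟ 0ℤ ] * tb u) * lookup u i
    split : ∀ u → vote T u * lookup u i ≡ majority u + tie u
    split u = ℤP.*-distribʳ-+ (lookup u i) (sgn (sumℤ u)) (𝟙[ sumℤ u ≟ 0ℤ ] * tb u)

  vote-half-correlation-≥ : ∀ i → β - 1ℤ ℤ.≤ Σ± r (λ x → vote T (1ℤ ∷ x) * lookup (1ℤ ∷ x) i)
  vote-half-correlation-≥ i = halve-≤ β _
    (subst ((β + β) - + 2 ℤ.≤_) (Σ±-even r (λ u → vote T u * lookup u i) even) (vote-correlation-≥ i))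
    where
    neg*neg : ∀ a b → - a * - b ≡ a * b
    neg*neg = solve-∀
    even : ∀ u → vote T (negate u) * lookup (negate u) i ≡ vote T u * lookup u i
    even u = trans (cong₂ _*_ (vote-odd T u) (VP.lookup-map i (λ a → - a) u)) (neg*neg (vote T u) (lookup u i))

Σₗ : ∀ {A : Set} → List A → (A → ℤ) → ℤ
Σₗ []       h = 0ℤ
Σₗ (v ∷ vs) h = h v + Σₗ vs h

Σₗ-++ : ∀ {A : Set} (xs ys : List A) h → Σₗ (xs ++ ys) h ≡ Σₗ xs h + Σₗ ys h
Σₗ-++ []       ys h = sym (ℤP.+-identityˡ _)
Σₗ-++ (x ∷ xs) ys h = trans (cong (λ z → h x + z) (Σₗ-++ xs ys h)) (sym (ℤP.+-assoc (h x) _ _))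

Σₗ-map : ∀ {A B : Set} (f : A → B) xs h → Σₗ (L.map f xs) h ≡ Σₗ xs (h ∘ f)
Σₗ-map f []       h = refl
Σₗ-map f (x ∷ xs) h = cong (λ z → h (f x) + z) (Σₗ-map f xs h)

Σₗ-filter : ∀ {A : Set} (f φ : A → ℤ) xs → All (IsSign ∘ f) xs →
  let S = filter (λ v → f v ≟ 1ℤ) xs in
  (Σₗ S φ + Σₗ S φ) - Σₗ xs φ ≡ Σₗ xs (λ v → f v * φ v)
Σₗ-filter f φ []       []         = refl
Σₗ-filter {A} f φ (x ∷ xs) (sfx ∷ sf) with f x ≟ 1ℤ | sfx
... | yes fx≡1 | _ = trans (shuffle (φ x) (Σₗ S φ) (Σₗ xs φ))
    (cong₂ _+_ (trans (sym (ℤP.*-identityˡ (φ x))) (cong (_* φ x) (sym fx≡1))) (Σₗ-filter f φ xs sf))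
  where
  S : List A
  S = filter (λ v → f v ≟ 1ℤ) xs
  shuffle : ∀ y a t → ((y + a) + (y + a)) - (y + t) ≡ y + ((a + a) - t)
  shuffle = solve-∀
... | no fx≢1 | inj₁ fx≡1  = contradiction fx≡1 fx≢1
... | no _    | inj₂ fx≡-1 = trans (shuffle (φ x) (Σₗ S φ) (Σₗ xs φ))
    (cong₂ _+_ (cong (_* φ x) (sym fx≡-1)) (Σₗ-filter f φ xs sf))
  where
  S : List A
  S = filter (λ v → f v ≟ 1ℤ) xs
  shuffle : ∀ y a t → (a + a) - (y + t) ≡ -1ℤ * y + ((a + a) - t)
  shuffle = solve-∀

Σₗ-sublist-≤ : ∀ {A : Set} (φ : A → ℤ) {S xs} → S ⊆ xs → All (IsSign ∘ φ) xs →
  (Σₗ S φ + Σₗ S φ) - Σₗ xs φ ℤ.≤ + length xs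
Σₗ-sublist-≤ φ []                  []          = ℤP.≤-refl
Σₗ-sublist-≤ φ {S} {x ∷ xs} (_ ∷ʳ S⊆xs) (sx ∷ sxs) = subst (ℤ._≤ 1ℤ + + length xs)
  (shuffle (φ x) (Σₗ S φ) (Σₗ xs φ))
  (ℤP.+-mono-≤ (-sign≤1 sx) (Σₗ-sublist-≤ φ S⊆xs sxs))
  where
  -sign≤1 : ∀ {a} → IsSign a → - a ℤ.≤ 1ℤ
  -sign≤1 (inj₁ refl) = ℤ.-≤+
  -sign≤1 (inj₂ refl) = ℤP.≤-refl
  shuffle : ∀ y a t → - y + ((a + a) - t) ≡ (a + a) - (y + t)
  shuffle = solve-∀
Σₗ-sublist-≤ φ {x ∷ S} {x ∷ xs} (refl ∷ S⊆xs) (sx ∷ sxs) = subst (ℤ._≤ 1ℤ + + length xs)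
  (shuffle (φ x) (Σₗ S φ) (Σₗ xs φ))
  (ℤP.+-mono-≤ (sign≤1 sx) (Σₗ-sublist-≤ φ S⊆xs sxs))
  where
  sign≤1 : ∀ {a} → IsSign a → a ℤ.≤ 1ℤ
  sign≤1 (inj₁ refl) = ℤP.≤-refl
  sign≤1 (inj₂ refl) = ℤ.-≤+
  shuffle : ∀ y a t → y + ((a + a) - t) ≡ ((y + a) + (y + a)) - (y + t)
  shuffle = solve-∀

⊆-map⁻¹ : ∀ {A B : Set} (f : A → B) ys {S} → S ⊆ L.map f ys →
          ∃ λ S′ → S′ ⊆ ys × S ≡ L.map f S′
⊆-map⁻¹ f []       []           = [] , [] , refl
⊆-map⁻¹ f (y ∷ ys) (_ ∷ʳ S⊆)    with ⊆-map⁻¹ f ys S⊆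
... | S′ , S′⊆ys , refl = S′ , y ∷ʳ S′⊆ys , refl
⊆-map⁻¹ f (y ∷ ys) (refl ∷ S⊆) with ⊆-map⁻¹ f ys S⊆
... | S′ , S′⊆ys , refl = y ∷ S′ , refl ∷ S′⊆ys , refl

cube : (m : ℕ) → List (Vec ℤ m)
cube zero    = [] ∷ []
cube (suc m) = L.map (1ℤ ∷_) (cube m) ++ L.map (-1ℤ ∷_) (cube m)

Σₗ-cube : ∀ m h → Σₗ (cube m) h ≡ Σ± m h
Σₗ-cube zero    h = ℤP.+-identityʳ (h [])
Σₗ-cube (suc m) h = trans (Σₗ-++ (L.map (1ℤ ∷_) (cube m)) _ h)
  (cong₂ _+_ (trans (Σₗ-map (1ℤ ∷_) (cube m) h) (Σₗ-cube m _))
             (trans (Σₗ-map (-1ℤ ∷_) (cube m) h) (Σₗ-cube m _)))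

cube-IsSignVec : ∀ m → All IsSignVec (cube m)
cube-IsSignVec zero    = VecAll.[] ∷ []
cube-IsSignVec (suc m) = All.++⁺ (All.map⁺ (All.map (inj₁ refl VecAll.∷_) (cube-IsSignVec m)))
                                 (All.map⁺ (All.map (inj₂ refl VecAll.∷_) (cube-IsSignVec m)))

length-cube : ∀ m → length (cube m) ≡ 2 ^ m
length-cube zero    = refl
length-cube (suc m) = begin
  length (L.map (1ℤ ∷_) (cube m) ++ L.map (-1ℤ ∷_) (cube m))
    ≡⟨ LP.length-++ (L.map (1ℤ ∷_) (cube m)) ⟩
  length (L.map (1ℤ ∷_) (cube m)) ℕ.+ length (L.map (-1ℤ ∷_) (cube m))
    ≡⟨ cong₂ ℕ._+_ (LP.length-map (1ℤ ∷_) (cube m)) (LP.length-map (-1ℤ ∷_) (cube m)) ⟩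
  length (cube m) ℕ.+ length (cube m)
    ≡⟨ cong₂ ℕ._+_ (length-cube m) (trans (length-cube m) (sym (ℕP.+-identityʳ (2 ^ m)))) ⟩
  2 ^ suc m ∎
  where open ≡-Reasoning

toℚᵥ : ∀ {m} → Vec ℤ m → Vecℚ m
toℚᵥ = Vec.map ℤ→ℚ

allPM≡cube : ∀ m → allPM m ≡ L.map toℚᵥ (cube m)
allPM≡cube zero    = refl
allPM≡cube (suc m) = begin
  L.map (1ℚ ∷_) (allPM m) ++ L.map (ℚ.- 1ℚ ∷_) (allPM m)
    ≡⟨ cong (λ c → L.map (1ℚ ∷_) c ++ L.map (ℚ.- 1ℚ ∷_) c) (allPM≡cube m) ⟩
  L.map (1ℚ ∷_) (L.map toℚᵥ (cube m)) ++ L.map (ℚ.- 1ℚ ∷_) (L.map toℚᵥ (cube m))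
    ≡⟨ cong₂ _++_ (sym (LP.map-∘ (cube m))) (sym (LP.map-∘ (cube m))) ⟩
  L.map (toℚᵥ ∘ (1ℤ ∷_)) (cube m) ++ L.map (toℚᵥ ∘ (-1ℤ ∷_)) (cube m)
    ≡⟨ cong₂ _++_ (LP.map-∘ (cube m)) (LP.map-∘ (cube m)) ⟩
  L.map toℚᵥ (L.map (1ℤ ∷_) (cube m)) ++ L.map toℚᵥ (L.map (-1ℤ ∷_) (cube m))
    ≡⟨ LP.map-++ toℚᵥ (L.map (1ℤ ∷_) (cube m)) _ ⟨
  L.map toℚᵥ (cube (suc m)) ∎
  where open ≡-Reasoning

Vset≡ : ∀ r → Vset (suc r) ≡ L.map toℚᵥ (L.map (1ℤ ∷_) (cube r))
Vset≡ r = trans (cong (L.map (1ℚ ∷_)) (allPM≡cube r)) (trans (sym (LP.map-∘ (cube r))) (LP.map-∘ (cube r)))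

ℤ→ℚ≡mkℚ : ∀ z → ℤ→ℚ z ≡ mkℚ z 0 (Coprime.sym (Coprime.1-coprimeTo ℤ.∣ z ∣))
ℤ→ℚ≡mkℚ z = ℚP.↥p/↧p≡p (mkℚ z 0 (Coprime.sym (Coprime.1-coprimeTo ℤ.∣ z ∣)))

ℤ→ℚ-+ : ∀ a b → ℤ→ℚ (a + b) ≡ ℤ→ℚ a ℚ.+ ℤ→ℚ b
ℤ→ℚ-+ a b = sym (trans (cong₂ ℚ._+_ (ℤ→ℚ≡mkℚ a) (ℤ→ℚ≡mkℚ b))
                       (cong ℤ→ℚ (cong₂ _+_ (ℤP.*-identityʳ a) (ℤP.*-identityʳ b))))

ℤ→ℚ-neg : ∀ a → ℤ→ℚ (- a) ≡ ℚ.- ℤ→ℚ a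
ℤ→ℚ-neg a = trans (ℤ→ℚ≡mkℚ (- a)) (trans (mkℚ-neg a) (cong ℚ.-_ (sym (ℤ→ℚ≡mkℚ a))))
  where
  mkℚ-neg : ∀ a → mkℚ (- a) 0 (Coprime.sym (Coprime.1-coprimeTo ℤ.∣ - a ∣))
                ≡ ℚ.- mkℚ a 0 (Coprime.sym (Coprime.1-coprimeTo ℤ.∣ a ∣))
  mkℚ-neg +0       = refl
  mkℚ-neg +[1+ _ ] = refl
  mkℚ-neg -[1+ _ ] = refl

ℤ→ℚ-minus : ∀ a b → ℤ→ℚ (a - b) ≡ ℤ→ℚ a ℚ.- ℤ→ℚ b
ℤ→ℚ-minus a b = trans (ℤ→ℚ-+ a (- b)) (cong (ℤ→ℚ a ℚ.+_) (ℤ→ℚ-neg b))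

ℤ→ℚ-mono-≤ : ∀ {a b} → a ℤ.≤ b → ℤ→ℚ a ℚ.≤ ℤ→ℚ b
ℤ→ℚ-mono-≤ {a} {b} a≤b = subst₂ ℚ._≤_ (sym (ℤ→ℚ≡mkℚ a)) (sym (ℤ→ℚ≡mkℚ b))
  (ℚ.*≤* (subst₂ ℤ._≤_ (sym (ℤP.*-identityʳ a)) (sym (ℤP.*-identityʳ b)) a≤b))

ℤ→ℚ-[x+y]-z : ∀ x y z → ℤ→ℚ ((x + y) - z) ≡ (ℤ→ℚ x ℚ.+ ℤ→ℚ y) ℚ.- ℤ→ℚ z
ℤ→ℚ-[x+y]-z x y z = trans (ℤ→ℚ-minus (x + y) z) (cong (ℚ._- ℤ→ℚ z) (ℤ→ℚ-+ x y))

ℤ→ℚ-[x-y]+z : ∀ x y z → ℤ→ℚ ((x - y) + z) ≡ (ℤ→ℚ x ℚ.- ℤ→ℚ y) ℚ.+ ℤ→ℚ z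
ℤ→ℚ-[x-y]+z x y z = trans (ℤ→ℚ-+ (x - y) z) (cong (ℚ._+ ℤ→ℚ z) (ℤ→ℚ-minus x y))

lookup-vsum : ∀ {m} (S : List (Vec ℤ m)) i →
              lookup (vsum (L.map toℚᵥ S)) i ≡ ℤ→ℚ (Σₗ S (λ v → lookup v i))
lookup-vsum []      i = VP.lookup-replicate i 0ℚ
lookup-vsum (v ∷ S) i = begin
  lookup (toℚᵥ v +ᵥ vsum (L.map toℚᵥ S)) i
    ≡⟨ VP.lookup-zipWith ℚ._+_ i (toℚᵥ v) _ ⟩
  lookup (toℚᵥ v) i ℚ.+ lookup (vsum (L.map toℚᵥ S)) i
    ≡⟨ cong₂ ℚ._+_ (VP.lookup-map i ℤ→ℚ v) (lookup-vsum S i) ⟩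
  ℤ→ℚ (lookup v i) ℚ.+ ℤ→ℚ (Σₗ S (λ v → lookup v i))
    ≡⟨ ℤ→ℚ-+ (lookup v i) _ ⟨
  ℤ→ℚ (Σₗ (v ∷ S) (λ v → lookup v i)) ∎
  where open ≡-Reasoning

lookup-shift : ∀ n w p i → lookup (shift n w p) i ≡
  ((lookup p i ℚ.- lookup (g n) i) ℚ.- halfBinom n ℚ.* 1ℚ) ℚ.+ ½ ℚ.* ℤ→ℚ (lookup w i)
lookup-shift n w p i = begin
  lookup (shift n w p) i
    ≡⟨ VP.lookup-zipWith ℚ._+_ i ((p -ᵥ g n) -ᵥ (halfBinom n ·ᵥ 1ᵥ)) _ ⟩
  lookup ((p -ᵥ g n) -ᵥ (halfBinom n ·ᵥ 1ᵥ)) i ℚ.+ lookup (½ ·ᵥ Vec.map ℤ→ℚ w) i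
    ≡⟨ cong₂ ℚ._+_ (VP.lookup-zipWith ℚ._-_ i (p -ᵥ g n) _)
                   (trans (VP.lookup-map i (½ ℚ.*_) (Vec.map ℤ→ℚ w))
                          (cong (½ ℚ.*_) (VP.lookup-map i ℤ→ℚ w))) ⟩
  (lookup (p -ᵥ g n) i ℚ.- lookup (halfBinom n ·ᵥ 1ᵥ) i) ℚ.+ ½ ℚ.* ℤ→ℚ (lookup w i)
    ≡⟨ cong₂ (λ a b → (a ℚ.- b) ℚ.+ ½ ℚ.* ℤ→ℚ (lookup w i)) (VP.lookup-zipWith ℚ._-_ i p (g n))
             (trans (VP.lookup-map i (halfBinom n ℚ.*_) 1ᵥ)
                    (cong (halfBinom n ℚ.*_) (VP.lookup-replicate i 1ℚ))) ⟩
  ((lookup p i ℚ.- lookup (g n) i) ℚ.- halfBinom n ℚ.* 1ℚ) ℚ.+ ½ ℚ.* ℤ→ℚ (lookup w i) ∎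
  where open ≡-Reasoning

ShiftedSubsetSumsInK : ℕ → Set
ShiftedSubsetSumsInK n = Σ (Vec ℤ n) λ w →
  ((i : Fin n) → lookup w i ℤ.≤ + 1) ×
  (Σ (Vecℚ n) (λ p → InP (Vset n) p × (shift n w p ≡ 0ᵥ))) ×
  ((p : Vecℚ n) → InP (Vset n) p → InK n (Mval n) (shift n w p))

twice/2 : ∀ m → twice m ℕ./ 2 ≡ m
twice/2 m = trans (cong (ℕ._/ 2) (trans (twice≡+ m) (cong (m ℕ.+_) (sym (ℕP.+-identityʳ m)))))
                  (trans (cong (ℕ._/ 2) (ℕP.*-comm 2 m)) (m*n/n≡m m 2))

module _ (h : ℕ) (T : TieBreaker (twice (suc h))) where
  private
    n : ℕ
    n = twice (suc h)
    r : ℕ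
    r = suc (twice h)
    β : ℤ
    β = + (r C suc h)
    P : ℕ
    P = 2 ^ twice h

    V : List (Vec ℤ n)
    V = L.map (1ℤ ∷_) (cube r)

    coord : Fin n → Vec ℤ n → ℤ
    coord i v = lookup v i

    S₀ : List (Vec ℤ n)
    S₀ = filter (λ v → vote T v ≟ 1ℤ) V

    D : Fin n → ℤ
    D i = Σₗ V (λ v → vote T v * coord i v)

    w : Vec ℤ n
    w = tabulate (λ i → β - D i)

    β-1≤D : ∀ i → β - 1ℤ ℤ.≤ D i
    β-1≤D i = subst (β - 1ℤ ℤ.≤_)
      (sym (trans (Σₗ-map (1ℤ ∷_) (cube r) _) (Σₗ-cube r _)))
      (vote-half-correlation-≥ h T i)

    w≤1 : ∀ i → lookup w i ℤ.≤ + 1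
    w≤1 i = begin
      lookup w i         ≡⟨ VP.lookup∘tabulate (λ i → β - D i) i ⟩
      β - D i            ≤⟨ ℤP.+-monoʳ-≤ β (ℤP.neg-mono-≤ (β-1≤D i)) ⟩
      β - (β - 1ℤ)       ≡⟨ cancel β ⟩
      + 1                ∎
      where
      open ℤP.≤-Reasoning
      cancel : ∀ b → b - (b - 1ℤ) ≡ 1ℤ
      cancel = solve-∀

    halfBinom≡ : halfBinom n ≡ ½ ℚ.* ℤ→ℚ β
    halfBinom≡ = cong (λ k → ½ ℚ.* ℕ→ℚ (r C k)) (twice/2 (suc h))

    lookup-g : ∀ i → lookup (g n) i ≡ ½ ℚ.* ℤ→ℚ (Σₗ V (coord i))
    lookup-g i = trans (VP.lookup-map i (½ ℚ.*_) (vsum (Vset n)))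
      (cong (½ ℚ.*_) (trans (cong (λ vs → lookup (vsum vs) i) (Vset≡ r)) (lookup-vsum V i)))

    lookup-shift-sum : ∀ w′ S i → lookup (shift n w′ (vsum (L.map toℚᵥ S))) i ≡
      ½ ℚ.* ℤ→ℚ ((((Σₗ S (coord i) + Σₗ S (coord i)) - Σₗ V (coord i)) - β) + lookup w′ i)
    lookup-shift-sum w′ S i = begin
      lookup (shift n w′ (vsum (L.map toℚᵥ S))) i
        ≡⟨ lookup-shift n w′ (vsum (L.map toℚᵥ S)) i ⟩
      ((lookup (vsum (L.map toℚᵥ S)) i ℚ.- lookup (g n) i) ℚ.- halfBinom n ℚ.* 1ℚ) ℚ.+ ½ ℚ.* ℤ→ℚ c
        ≡⟨ cong₃ (λ a v b → ((a ℚ.- v) ℚ.- b ℚ.* 1ℚ) ℚ.+ ½ ℚ.* ℤ→ℚ c)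
                 (lookup-vsum S i) (lookup-g i) halfBinom≡ ⟩
      ((ℤ→ℚ a ℚ.- ½ ℚ.* ℤ→ℚ v) ℚ.- (½ ℚ.* ℤ→ℚ β) ℚ.* 1ℚ) ℚ.+ ½ ℚ.* ℤ→ℚ c
        ≡⟨ collect-½ (ℤ→ℚ a) (ℤ→ℚ v) (ℤ→ℚ β) (ℤ→ℚ c) ⟩
      ½ ℚ.* ((((ℤ→ℚ a ℚ.+ ℤ→ℚ a) ℚ.- ℤ→ℚ v) ℚ.- ℤ→ℚ β) ℚ.+ ℤ→ℚ c)
        ≡⟨ cong (λ z → ½ ℚ.* ((z ℚ.- ℤ→ℚ β) ℚ.+ ℤ→ℚ c)) (ℤ→ℚ-[x+y]-z a a v) ⟨
      ½ ℚ.* ((ℤ→ℚ ((a + a) - v) ℚ.- ℤ→ℚ β) ℚ.+ ℤ→ℚ c)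
        ≡⟨ cong (½ ℚ.*_) (ℤ→ℚ-[x-y]+z ((a + a) - v) β c) ⟨
      ½ ℚ.* ℤ→ℚ ((((a + a) - v) - β) + c) ∎
      where
      open ≡-Reasoning
      a v c : ℤ
      a = Σₗ S (coord i)
      v = Σₗ V (coord i)
      c = lookup w′ i
      open ℚSolver.+-*-Solver
      collect-½ : ∀ a v b c → ((a ℚ.- ½ ℚ.* v) ℚ.- (½ ℚ.* b) ℚ.* 1ℚ) ℚ.+ ½ ℚ.* c
                             ≡ ½ ℚ.* ((((a ℚ.+ a) ℚ.- v) ℚ.- b) ℚ.+ c)
      collect-½ = solve 4 (λ a v b c → ((a :- con ½ :* v) :- (con ½ :* b) :* con 1ℚ) :+ con ½ :* c
                                      := con ½ :* ((((a :+ a) :- v) :- b) :+ c)) refl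

    Mval≡ : Mval n ≡ ½ ℚ.* ℤ→ℚ (((+ P + + P) - β) + 1ℤ)
    Mval≡ = begin
      (ℤ→ℚ (+ P) ℚ.- halfBinom n) ℚ.+ ½
        ≡⟨ cong (λ b → (ℤ→ℚ (+ P) ℚ.- b) ℚ.+ ½) halfBinom≡ ⟩
      (ℤ→ℚ (+ P) ℚ.- ½ ℚ.* ℤ→ℚ β) ℚ.+ ½
        ≡⟨ collect-½ (ℤ→ℚ (+ P)) (ℤ→ℚ β) ⟩
      ½ ℚ.* (((ℤ→ℚ (+ P) ℚ.+ ℤ→ℚ (+ P)) ℚ.- ℤ→ℚ β) ℚ.+ 1ℚ)
        ≡⟨ cong (λ z → ½ ℚ.* ((z ℚ.- ℤ→ℚ β) ℚ.+ 1ℚ)) (ℤ→ℚ-+ (+ P) (+ P)) ⟨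
      ½ ℚ.* ((ℤ→ℚ (+ P + + P) ℚ.- ℤ→ℚ β) ℚ.+ 1ℚ)
        ≡⟨ cong (½ ℚ.*_) (ℤ→ℚ-[x-y]+z (+ P + + P) β 1ℤ) ⟨
      ½ ℚ.* ℤ→ℚ (((+ P + + P) - β) + 1ℤ) ∎
      where
      open ≡-Reasoning
      open ℚSolver.+-*-Solver
      collect-½ : ∀ p b → (p ℚ.- ½ ℚ.* b) ℚ.+ ½ ≡ ½ ℚ.* (((p ℚ.+ p) ℚ.- b) ℚ.+ 1ℚ)
      collect-½ = solve 2 (λ p b → (p :- con ½ :* b) :+ con ½
                                  := con ½ :* (((p :+ p) :- b) :+ con 1ℚ)) refl

    length-V : + length V ≡ + P + + P
    length-V = cong +_ (begin
      length V              ≡⟨ LP.length-map (1ℤ ∷_) (cube r) ⟩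
      length (cube r)       ≡⟨ length-cube r ⟩
      P ℕ.+ (P ℕ.+ 0)       ≡⟨ cong (P ℕ.+_) (ℕP.+-identityʳ P) ⟩
      P ℕ.+ P               ∎)
      where open ≡-Reasoning

    V-IsSignVec : All IsSignVec V
    V-IsSignVec = All.map⁺ (All.map (inj₁ refl VecAll.∷_) (cube-IsSignVec r))

    shift-S₀≡0 : shift n w (vsum (L.map toℚᵥ S₀)) ≡ 0ᵥ
    shift-S₀≡0 = Pointwise-≡⇒≡ (ext λ i → begin
      lookup (shift n w (vsum (L.map toℚᵥ S₀))) i
        ≡⟨ lookup-shift-sum w S₀ i ⟩
      ½ ℚ.* ℤ→ℚ ((((Σₗ S₀ (coord i) + Σₗ S₀ (coord i)) - Σₗ V (coord i)) - β) + lookup w i)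
        ≡⟨ cong₂ (λ d c → ½ ℚ.* ℤ→ℚ ((d - β) + c))
                 (Σₗ-filter (vote T) (coord i) V (All.map (vote-sign T _) V-IsSignVec))
                 (VP.lookup∘tabulate (λ i → β - D i) i) ⟩
      ½ ℚ.* ℤ→ℚ ((D i - β) + (β - D i))
        ≡⟨ cong (λ z → ½ ℚ.* ℤ→ℚ z) (cancel (D i) β) ⟩
      0ℚ
        ≡⟨ VP.lookup-replicate i 0ℚ ⟨
      lookup 0ᵥ i ∎)
      where
      open ≡-Reasoning
      cancel : ∀ d b → (d - b) + (b - d) ≡ 0ℤ
      cancel = solve-∀

    shift-sublist≤M : ∀ S → S ⊆ V → ∀ i → lookup (shift n w (vsum (L.map toℚᵥ S))) i ℚ.≤ Mval n
    shift-sublist≤M S S⊆V i = subst₂ ℚ._≤_ (sym (lookup-shift-sum w S i)) (sym Mval≡)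
      (ℚP.*-monoˡ-≤-nonNeg ½ (ℤ→ℚ-mono-≤ (ℤP.+-mono-≤
        (ℤP.+-monoˡ-≤ (- β) (subst ((Σₗ S (coord i) + Σₗ S (coord i)) - Σₗ V (coord i) ℤ.≤_) length-V
          (Σₗ-sublist-≤ (coord i) S⊆V (All.map (λ sv → VecAll.lookup⁺ sv i) V-IsSignVec))))
        (w≤1 i))))

  shiftedSubsetSumsInK : ShiftedSubsetSumsInK n
  shiftedSubsetSumsInK =
    w , w≤1 , (vsum (L.map toℚᵥ S₀) , (L.map toℚᵥ S₀ , S₀⊆Vset , refl) , shift-S₀≡0) , in-K
    where
    S₀⊆Vset : L.map toℚᵥ S₀ ⊆ Vset n
    S₀⊆Vset = subst (L.map toℚᵥ S₀ ⊆_) (sym (Vset≡ r))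
                    (Sublist.map⁺ toℚᵥ (Sublist.filter-⊆ (λ v → vote T v ≟ 1ℤ) V))
    in-K : (p : Vecℚ n) → InP (Vset n) p → InK n (Mval n) (shift n w p)
    in-K p (S , S⊆Vset , refl) i with ⊆-map⁻¹ toℚᵥ V (subst (S ⊆_) (Vset≡ r) S⊆Vset)
    ... | S′ , S′⊆V , refl = shift-sublist≤M S′ S′⊆V i

lemma7 : (k : ℕ) → 1 ≤ k →
    Σ (Vec ℤ (2 ^ k)) λ w →
      ((i : Fin (2 ^ k)) → lookup w i ℤ.≤ + 1) ×
      (Σ (Vecℚ (2 ^ k)) (λ p → InP (Vset (2 ^ k)) p × (shift (2 ^ k) w p ≡ 0ᵥ))) ×
      ((p : Vecℚ (2 ^ k)) → InP (Vset (2 ^ k)) p → InK (2 ^ k) (Mval (2 ^ k)) (shift (2 ^ k) w p))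
lemma7 (suc k) _ with pow2-positive k
... | h , pow2k≡1+h = subst ShiftedSubsetSumsInK n≡2^k
        (shiftedSubsetSumsInK h (subst TieBreaker (cong twice pow2k≡1+h) (tieBreaker k)))
  where
  n≡2^k : twice (suc h) ≡ 2 ^ suc k
  n≡2^k = trans (cong twice (sym pow2k≡1+h)) (pow2≡2^ (suc k))
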